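{- Let $1\le k\le d-1$ be integers. If $d-k$ is even, then $$n(k,d)\le \sum_{j=0}^{\frac{d-k-2}{2}}\left(\frac{1}{2^{j+1}}-\frac{1}{2^{d-k-j}}\right)\left|B_{k+2j}^{(d)}\right|+2^{\frac{d+k}{2}}.$$ If $d-k$ is odd, then $$n(k,d)\le \sum_{j=0}^{\frac{d-k-3}{2}}\left(\frac{1}{2^{j+1}}-\frac{1}{2^{d-k-j}}\right)\left|B_{k+2j}^{(d)}\right|+\frac{1}{2^{\frac{d-k+1}{2}}}\left|B_{d-1}^{(d)}\right|+2^{\frac{d+k-1}{2}}.$$
   Context: A standard box in $\mathbb{R}^d$ is a set $K=K_1\times\cdots\times K_d$ where each $K_i\subseteq\mathbb{R}$ is a closed interval. A finite family of $d$-dimensional standard boxes in $\mathbb{R}^d$ is called $k$-neighborly if the dimension of the intersection of any two distinct members is in $\{d-k,d-k+1,\ldots,d-1\}$ (in particular the intersection is nonempty). For positive integers $1\le k\le d$, $n(k,d)$ is the maximum number of members of a $k$-neighborly family of $d$-dimensional standard boxes in $\mathbb{R}^d$. For a nonnegative integer $m\le d-1$, the configuration $B_m^{(d)}\subseteq\{0,1\}^d$ is defined as follows: if $m=2t$, it is the set of binary vectors of length $d$ with at most $t$ coordinates equal to $1$; if $m=2t+1$, it is the Cartesian product of $\{0,1\}$ with the set of binary vectors of length $d-1$ with at most $t$ coordinates equal to $1$. Thus $|B_m^{(d)}|=\sum_{i=0}^{t}\binom{d}{i}$ if $m=2t$, and $|B_m^{(d)}|=2\sum_{i=0}^{t}\binom{d-1}{i}$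 if $m=2t+1$. Empty sums (upper limit smaller than the lower limit) equal $0$. -}

module Defs where

open import Data.Bool.Base using (Bool; true; false)
open import Data.Fin.Base using (Fin)
open import Data.Fin.Subset using (Subset; _∈_; _∉_; ∣_∣)
open import Data.Integer.Base using (+_)
open import Data.List.Base using (List; []; _∷_; [_]; filter; cartesianProductWith)
open import Data.Nat.Base as ℕ using (ℕ; zero; suc; _∸_; _^_; ⌊_/2⌋; parity)
open import Data.Nat.Properties using (m^n≢0; _≤?_)
open import Data.Parity.Base using (Parity; 0ℙ; 1ℙ)
open import Data.Product.Base using (Σ-syntax; ∃-syntax; ∃; _×_)
open import Data.Rational.Base as ℚ using (ℚ)
open import Data.Sum.Base using (_⊎_)
open import Data.Vec.Base using (Vec; []; _∷_)
open import Data.Vec.Functional using (Vector)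
open import Function.Bundles using (_⇔_)
open import Level using (0ℓ)
open import Relation.Binary.PropositionalEquality.Core using (_≡_; _≢_)
open import Relation.Nullary.Negation.Core using (¬_)
open import Relation.Unary using (Pred; _⊆_; _∩_; _≐_)

-- Real numbers as two-sided Dedekind cuts of ℚ.  Only their order is needed.
record ℝ : Set₁ where
  field
    Lower Upper     : Pred ℚ 0ℓ
    lower-inhabited : ∃ Lower
    upper-inhabited : ∃ Upper
    lower-rounded   : ∀ q → Lower q ⇔ (∃[ r ] q ℚ.< r × Lower r)
    upper-rounded   : ∀ r → Upper r ⇔ (∃[ q ] q ℚ.< r × Upper q)
    disjoint        : ∀ q → ¬ (Lower q × Upper q)
    located         : ∀ {q r} → q ℚ.< r → Lower q ⊎ Upper r

infix 4 _≤ᴿ_ _<ᴿ_ _≈ᴿ_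

_≤ᴿ_ : ℝ → ℝ → Set
x ≤ᴿ y = ℝ.Lower x ⊆ ℝ.Lower y

_<ᴿ_ : ℝ → ℝ → Set
x <ᴿ y = ∃[ q ] ℝ.Upper x q × ℝ.Lower y q

_≈ᴿ_ : ℝ → ℝ → Set
x ≈ᴿ y = x ≤ᴿ y × y ≤ᴿ x

-- A product of d compact intervals.  A side may be a single point, so that
-- nonempty intersections of boxes are again boxes.
record Box (d : ℕ) : Set₁ where
  field
    lo hi : Vector ℝ d
    lo≤hi : ∀ i → lo i ≤ᴿ hi i

⟦_⟧ : ∀ {d} → Box d → Pred (Vector ℝ d) 0ℓ
⟦ K ⟧ x = ∀ i → Box.lo K i ≤ᴿ x i × x i ≤ᴿ Box.hi K i

-- The dimension of a box is the number of its nondegenerate sides; S is the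
-- set of their indices.
HasDimension : ∀ {d} → Box d → ℕ → Set
HasDimension {d} K e = Σ[ S ∈ Subset d ] ∣ S ∣ ≡ e
  × (∀ {i} → i ∈ S → Box.lo K i <ᴿ Box.hi K i)
  × (∀ {i} → i ∉ S → Box.lo K i ≈ᴿ Box.hi K i)

-- The set A is a box of dimension e; in particular A is nonempty.
IsBoxOfDimension : ∀ {d} → Pred (Vector ℝ d) 0ℓ → ℕ → Set₁
IsBoxOfDimension {d} A e = Σ[ M ∈ Box d ] A ≐ ⟦ M ⟧ × HasDimension M e

-- Members with different indices are automatically different boxes, because
-- the intersection of a d-dimensional box with itself has dimension d > d ∸ 1
-- (for d ≥ 1); hence m is the number of members.
record NeighborlyFamily (k d m : ℕ) : Set₁ where
  field
    box        : Fin m → Box d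
    full       : ∀ i → HasDimension (box i) d
    neighborly : ∀ i j → i ≢ j →
      ∃[ e ] d ∸ k ℕ.≤ e × e ℕ.≤ d ∸ 1 × IsBoxOfDimension (⟦ box i ⟧ ∩ ⟦ box j ⟧) e

-- n is the number n(k,d): the maximum size of a k-neighborly family of
-- d-dimensional boxes in ℝᵈ.
record IsNeighborlyNumber (k d n : ℕ) : Set₁ where
  field
    attained : NeighborlyFamily k d n
    maximal  : ∀ m → NeighborlyFamily k d m → m ℕ.≤ n

-- All of {0,1}ᵈ, each vector once; true stands for 1.
binaryVectors : ∀ d → List (Vec Bool d)
binaryVectors zero    = [ [] ]
binaryVectors (suc d) = cartesianProductWith _∷_ (false ∷ true ∷ []) (binaryVectors d)

-- For v : Vec Bool d = Subset d, the library's ∣ v ∣ counts the entries equal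
-- to true.
atMostOnes : ℕ → ∀ d → List (Vec Bool d)
atMostOnes t d = filter (λ v → ∣ v ∣ ≤? t) (binaryVectors d)

-- The configuration of index 2t (parity 0ℙ) or 2t + 1 (parity 1ℙ).  The case
-- of odd index and d = 0 lies outside the range m ≤ d ∸ 1 and is a dummy.
configuration : Parity → ℕ → ∀ d → List (Vec Bool d)
configuration 0ℙ t d       = atMostOnes t d
configuration 1ℙ t zero    = []
configuration 1ℙ t (suc d) = cartesianProductWith _∷_ (false ∷ true ∷ []) (atMostOnes t d)

-- The elements of B_m^(d), listed without repetition, so that its cardinality
-- is the length of the list.
B : ℕ → ∀ d → List (Vec Bool d)
B m d = configuration (parity m) ⌊ m /2⌋ d

fromℕ : ℕ → ℚ
fromℕ n = + n ℚ./ 1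

1/2^_ : ℕ → ℚ
1/2^ n = (+ 1 ℚ./ (2 ^ n)) {{m^n≢0 2 n}}

{-# OPTIONS --safe #-}
-- Ordering touching sides of the boxes turns a neighborly family into words
-- over {0,1,∗}, two distinct words being opposite (0 against 1) in at least one
-- and at most k positions.  Words then describe disjoint subcubes of {0,1}ᵈ, a
-- word with s jokers one of size 2ˢ.  The subcubes of the words with at most j
-- jokers form a set of diameter at most k + 2j, so by Kleitman's theorem their
-- total size is at most |B_{k+2j}|.  The bound is a positive combination of
-- these inequalities and of one more: if x lies in the subcube of a word with t
-- jokers and the antipode of x in that of a word with s jokers, then
-- s + t ≥ d − k, which allows points of {0,1}ᵈ to be shared between the two.
--
-- Kleitman's theorem for even diameter reduces by compression to families in
-- which all unions of two members are small, and these are bounded by shifting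
-- (Katona's theorem).
module Submission where

open import Defs

-- Write D = d - k = p + q with q = p or q = p + 1. A word with s jokers counts at every level j ≥
-- s, so the weighted volume bounds give it 2^s times the sum of 1/2^(j+1) - 1/2^(D-j) over s ≤ j <
-- p. This telescopes, and for D = 2p and s ≤ p it equals (1 - 2^(s-p))². What a word lacks to a
-- full unit is therefore 2·2^(s-p) - 4^(s-p), and the constant term 2^(d-p) = 2^((d+k)/2) has to
-- pay for all these defects. Disjointness of the subcubes pays only 2^(s-p) per word. The other
-- part, 2^(s-p)(1 - 2^(s-p)), is charged to the antipodes of the points of the subcube. If such an
-- antipode is itself covered, then by a word with t ≥ D - s jokers. This word has more than p
-- jokers when s < p, so it reaches its unit with the share 2^(p-t) at each of its points, and what
-- it leaves there is enough. The count is carried out in ℕ after multiplication by 2^D, where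
-- truncated subtraction removes the antipodal charge for s ≥ p.

module Hypercube where

  open import Data.Bool.Base using (Bool; true; false; T; not; _∧_; _∨_; _xor_; if_then_else_)
  open import Data.Bool.Properties using (T-∧; T-∨; not-involutive)
  open import Data.Fin.Base using (Fin; zero; suc)
  open import Data.Fin.Subset using (∣_∣; _∪_; ∁)
  open import Data.Fin.Subset.Properties using (∣⊤∣≡n; p∪∁p≡⊤; ∪-idem)
  open import Data.List.Base as List using (length; filter)
  open import Data.List.Properties using (length-map; length-++; filter-++; ++-identityʳ)
  open import Data.Nat.Base
  open import Data.Nat.Properties
  open import Data.Nat.Solver using (module +-*-Solver)
  open import Data.Parity.Base using (0ℙ; 1ℙ)
  open import Data.Product.Base using (_×_; _,_; proj₁; proj₂; ∃-syntax)
  open import Data.Sum.Base using (_⊎_; inj₁; inj₂; [_,_])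
  open import Data.Vec.Base using (Vec; []; _∷_; zipWith; lookup; _[_]≔_)
  open import Function.Base using (_∘_)
  open import Function.Bundles using (Equivalence)
  open import Relation.Binary.PropositionalEquality hiding ([_])
  open import Relation.Nullary using (does; yes; no; ¬_; contradiction)
  open import Relation.Unary using (Decidable)
  open import Algebra.Properties.CommutativeMonoid.Sum +-0-commutativeMonoid
    using (sum-syntax; sum; ∑-distrib-+)
  open import Algebra.Properties.CommutativeSemigroup +-commutativeSemigroup using (interchange)
  open +-*-Solver using (solve; _:+_; _:*_; _:=_; con)

  -- Families of binary vectors and sums over the cube.

  χ : Bool → ℕ
  χ b = if b then 1 else 0

  Family : ℕ → Set
  Family d = Vec Bool d → Bool

  Σᶜ : ∀ {d} → (Vec Bool d → ℕ) → ℕ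
  Σᶜ {zero}  f = f []
  Σᶜ {suc d} f = Σᶜ (f ∘ (false ∷_)) + Σᶜ (f ∘ (true ∷_))

  card : ∀ {d} → Family d → ℕ
  card P = Σᶜ (χ ∘ P)

  Σᶜ-mono : ∀ {d} {f g : Vec Bool d → ℕ} → (∀ x → f x ≤ g x) → Σᶜ f ≤ Σᶜ g
  Σᶜ-mono {zero}  f≤g = f≤g []
  Σᶜ-mono {suc d} f≤g = +-mono-≤ (Σᶜ-mono (f≤g ∘ (false ∷_))) (Σᶜ-mono (f≤g ∘ (true ∷_)))

  Σᶜ-cong : ∀ {d} {f g : Vec Bool d → ℕ} → (∀ x → f x ≡ g x) → Σᶜ f ≡ Σᶜ g
  Σᶜ-cong {zero}  f≡g = f≡g []
  Σᶜ-cong {suc d} f≡g = cong₂ _+_ (Σᶜ-cong (f≡g ∘ (false ∷_))) (Σᶜ-cong (f≡g ∘ (true ∷_)))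

  Σᶜ-+ : ∀ {d} (f g : Vec Bool d → ℕ) → Σᶜ (λ x → f x + g x) ≡ Σᶜ f + Σᶜ g
  Σᶜ-+ {zero}  f g = refl
  Σᶜ-+ {suc d} f g = trans (cong₂ _+_ (Σᶜ-+ (f ∘ (false ∷_)) (g ∘ (false ∷_))) (Σᶜ-+ (f ∘ (true ∷_)) (g ∘ (true ∷_))))
    (interchange (Σᶜ (f ∘ (false ∷_))) (Σᶜ (g ∘ (false ∷_))) (Σᶜ (f ∘ (true ∷_))) (Σᶜ (g ∘ (true ∷_))))

  Σᶜ-const : ∀ d c → Σᶜ {d} (λ _ → c) ≡ 2 ^ d * c
  Σᶜ-const zero    c = sym (*-identityˡ c)
  Σᶜ-const (suc d) c = begin
    Σᶜ {d} (λ _ → c) + Σᶜ {d} (λ _ → c)  ≡⟨ cong (λ s → s + s) (Σᶜ-const d c) ⟩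
    2 ^ d * c + 2 ^ d * c                ≡⟨ solve 2 (λ a b → a :* b :+ a :* b := (con 2 :* a) :* b) refl (2 ^ d) c ⟩
    2 ^ suc d * c                        ∎
    where open ≡-Reasoning

  Σᶜ-*ʳ : ∀ {d} (f : Vec Bool d → ℕ) c → Σᶜ (λ x → f x * c) ≡ Σᶜ f * c
  Σᶜ-*ʳ {zero}  f c = refl
  Σᶜ-*ʳ {suc d} f c = trans (cong₂ _+_ (Σᶜ-*ʳ (f ∘ (false ∷_)) c) (Σᶜ-*ʳ (f ∘ (true ∷_)) c)) (sym (*-distribʳ-+ c (Σᶜ (f ∘ (false ∷_))) _))

  Σᶜ-∁ : ∀ {d} (f : Vec Bool d → ℕ) → Σᶜ (f ∘ ∁) ≡ Σᶜ f
  Σᶜ-∁ {zero}  f = refl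
  Σᶜ-∁ {suc d} f = trans (cong₂ _+_ (Σᶜ-∁ (f ∘ (true ∷_))) (Σᶜ-∁ (f ∘ (false ∷_)))) (+-comm (Σᶜ (f ∘ (true ∷_))) _)

  Σᶜ-∑ : ∀ {d n} (f : Fin n → Vec Bool d → ℕ) → Σᶜ (λ x → ∑[ v < n ] f v x) ≡ ∑[ v < n ] Σᶜ (f v)
  Σᶜ-∑ {zero}  {n} f = refl
  Σᶜ-∑ {suc d} {n} f = trans (cong₂ _+_ (Σᶜ-∑ (λ v → f v ∘ (false ∷_))) (Σᶜ-∑ (λ v → f v ∘ (true ∷_))))
    (sym (∑-distrib-+ (λ v → Σᶜ (f v ∘ (false ∷_))) (λ v → Σᶜ (f v ∘ (true ∷_)))))

  χ-∨-∧ : ∀ a b → χ (a ∨ b) + χ (a ∧ b) ≡ χ a + χ b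
  χ-∨-∧ false b = +-identityʳ (χ b)
  χ-∨-∧ true  b = refl

  χ≤1 : ∀ b → χ b ≤ 1
  χ≤1 false = z≤n
  χ≤1 true  = ≤-refl

  card-∨-∧ : ∀ {d} (P Q : Family d) →
    card (λ x → P x ∨ Q x) + card (λ x → P x ∧ Q x) ≡ card P + card Q
  card-∨-∧ P Q = trans (sym (Σᶜ-+ (λ x → χ (P x ∨ Q x)) (λ x → χ (P x ∧ Q x))))
    (trans (Σᶜ-cong (λ x → χ-∨-∧ (P x) (Q x))) (Σᶜ-+ (χ ∘ P) (χ ∘ Q)))

  infixl 6 _⊕_
  _⊕_ : ∀ {d} → Vec Bool d → Vec Bool d → Vec Bool d
  _⊕_ = zipWith _xor_

  -- Compression: from distances to unions.

  Antitone : (ℕ → Set) → Set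
  Antitone R = ∀ {n} → R (suc n) → R n

  -- In each coordinate in turn, every member with entry 1 is replaced by its
  -- neighbour with entry 0, unless that neighbour is already a member.
  down : ∀ {d} → Family d → Family d
  down P []          = P []
  down P (false ∷ x) = down (λ y → P (false ∷ y) ∨ P (true ∷ y)) x
  down P (true  ∷ x) = down (λ y → P (false ∷ y) ∧ P (true ∷ y)) x

  card-down : ∀ {d} (P : Family d) → card (down P) ≡ card P
  card-down {zero}  P = refl
  card-down {suc d} P = trans (cong₂ _+_ (card-down (λ y → P (false ∷ y) ∨ P (true ∷ y)))
                                              (card-down (λ y → P (false ∷ y) ∧ P (true ∷ y))))
    (card-∨-∧ (P ∘ (false ∷_)) (P ∘ (true ∷_)))

  ∨-elim : ∀ {a b} → T (a ∨ b) → T a ⊎ T b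
  ∨-elim = Equivalence.to T-∨

  ∧-elim : ∀ {a b} → T (a ∧ b) → T a × T b
  ∧-elim = Equivalence.to T-∧

  -- After compression, the size of a union is controlled by what the distance
  -- was before; R n stands for "n plus some offset is at most the diameter".
  down-∪ : ∀ {d} (P Q : Family d) (R : ℕ → Set) → Antitone R →
    (∀ x y → T (P x) → T (Q y) → R ∣ x ⊕ y ∣) →
    ∀ x y → T (down P x) → T (down Q y) → R ∣ x ∪ y ∣
  down-∪ P Q R R↓ h []          []          p q = h [] [] p q
  down-∪ P Q R R↓ h (false ∷ x) (false ∷ y) = down-∪ _ _ R R↓ h′ x y
    where
    h′ : ∀ x y → _ → _ → R ∣ x ⊕ y ∣
    h′ x y p q with ∨-elim p | ∨-elim q
    ... | inj₁ p₀ | inj₁ q₀ = h _ _ p₀ q₀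
    ... | inj₁ p₀ | inj₂ q₁ = R↓ (h _ _ p₀ q₁)
    ... | inj₂ p₁ | inj₁ q₀ = R↓ (h _ _ p₁ q₀)
    ... | inj₂ p₁ | inj₂ q₁ = h _ _ p₁ q₁
  down-∪ P Q R R↓ h (false ∷ x) (true  ∷ y) = down-∪ _ _ (R ∘ suc) R↓ h′ x y
    where
    h′ : ∀ x y → _ → _ → R (suc ∣ x ⊕ y ∣)
    h′ x y p q with ∨-elim p | ∧-elim q
    ... | inj₁ p₀ | q₀ , q₁ = h _ _ p₀ q₁
    ... | inj₂ p₁ | q₀ , q₁ = h _ _ p₁ q₀
  down-∪ P Q R R↓ h (true  ∷ x) (false ∷ y) = down-∪ _ _ (R ∘ suc) R↓ h′ x y
    where
    h′ : ∀ x y → _ → _ → R (suc ∣ x ⊕ y ∣)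
    h′ x y p q with ∧-elim p | ∨-elim q
    ... | p₀ , p₁ | inj₁ q₀ = h _ _ p₁ q₀
    ... | p₀ , p₁ | inj₂ q₁ = h _ _ p₀ q₁
  down-∪ P Q R R↓ h (true  ∷ x) (true  ∷ y) = down-∪ _ _ (R ∘ suc) R↓ h′ x y
    where
    h′ : ∀ x y → _ → _ → R (suc ∣ x ⊕ y ∣)
    -- Both neighbours belong to either family, so opposite heads can be chosen: the head then
    -- counts in the distance as it does in the union.
    h′ x y p q = h _ _ (proj₁ (∧-elim p)) (proj₂ (∧-elim q))

  -- Shifting away from the head coordinate.

  mutual
    -- The shift replacing the head coordinate by any other coordinate,
    -- performed successively for all of them.
    shift : ∀ {d} → Family (suc d) → Family (suc d)
    shift P (h ∷ [])        = P (h ∷ [])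
    shift P (h ∷ false ∷ x) = shift (shift⁻ P) (h ∷ x)
    shift P (h ∷ true  ∷ x) = shift (shift⁺ P) (h ∷ x)

    -- The two sections, by the second coordinate, of `P` after the initial pattern 10 has been
    -- replaced by 01 wherever 01 was vacant.
    shift⁻ shift⁺ : ∀ {d} → Family (suc (suc d)) → Family (suc d)
    shift⁻ P (false ∷ x) = P (false ∷ false ∷ x)
    shift⁻ P (true  ∷ x) = P (true ∷ false ∷ x) ∧ P (false ∷ true ∷ x)
    shift⁺ P (false ∷ x) = P (true ∷ false ∷ x) ∨ P (false ∷ true ∷ x)
    shift⁺ P (true  ∷ x) = P (true ∷ true ∷ x)

  card-shift : ∀ {d} (P : Family (suc d)) → card (shift P) ≡ card P
  card-shift {zero}  P = refl
  card-shift {suc d} P = begin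
    (a + b) + (c + e)  ≡⟨ interchange a b c e ⟩
    (a + c) + (b + e)  ≡⟨ cong₂ _+_ (card-shift (shift⁻ P)) (card-shift (shift⁺ P)) ⟩
    (w + ∧′) + (∨′ + z) ≡⟨ solve 4 (λ w p q z → (w :+ p) :+ (q :+ z) := w :+ (q :+ p) :+ z) refl w ∧′ ∨′ z ⟩
    w + (∨′ + ∧′) + z  ≡⟨ cong (λ s → w + s + z) (card-∨-∧ (λ x → P (true ∷ false ∷ x)) (λ x → P (false ∷ true ∷ x))) ⟩
    w + (u + v) + z    ≡⟨ solve 4 (λ w u v z → w :+ (u :+ v) :+ z := (w :+ v) :+ (u :+ z)) refl w u v z ⟩
    (w + v) + (u + z)  ∎
    where
    open ≡-Reasoning
    a = card (λ x → shift (shift⁻ P) (false ∷ x))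
    b = card (λ x → shift (shift⁺ P) (false ∷ x))
    c = card (λ x → shift (shift⁻ P) (true ∷ x))
    e = card (λ x → shift (shift⁺ P) (true ∷ x))
    w = card (λ x → P (false ∷ false ∷ x))
    v = card (λ x → P (false ∷ true ∷ x))
    u = card (λ x → P (true ∷ false ∷ x))
    z = card (λ x → P (true ∷ true ∷ x))
    ∧′ = card (λ x → shift⁻ P (true ∷ x))
    ∨′ = card (λ x → shift⁺ P (false ∷ x))

  -- The recursion of `shift` strips the second coordinate and keeps the head, while `∣_∣` meets the
  -- head first.
  ∪-swap : ∀ {d} a b c e (x y : Vec Bool d) →
    ∣ (c ∷ a ∷ x) ∪ (e ∷ b ∷ y) ∣ ≡ ∣ (a ∷ c ∷ x) ∪ (b ∷ e ∷ y) ∣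
  ∪-swap a b c e x y with a ∨ b | c ∨ e
  ... | false | _     = refl
  ... | true  | false = refl
  ... | true  | true  = refl

  shift-∪ : ∀ {d} (P Q : Family (suc d)) (R : ℕ → Set) → Antitone R →
    (∀ x y → T (P x) → T (Q y) → R ∣ x ∪ y ∣) →
    ∀ x y → T (shift P x) → T (shift Q y) → R ∣ x ∪ y ∣
  shift-∪ P Q R R↓ h (a ∷ []) (b ∷ []) p q = h _ _ p q
  shift-∪ {suc d} P Q R R↓ h (a ∷ false ∷ x) (b ∷ false ∷ y) p q =
    subst R (∪-swap a b false false x y) (shift-∪ (shift⁻ P) (shift⁻ Q) R R↓ h′ (a ∷ x) (b ∷ y) p q)
    where
    h′ : ∀ x y → T (shift⁻ P x) → T (shift⁻ Q y) → R ∣ x ∪ y ∣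
    h′ (false ∷ x) (false ∷ y) p q = h _ _ p q
    h′ (false ∷ x) (true  ∷ y) p q = h _ _ p (proj₁ (∧-elim q))
    h′ (true  ∷ x) (false ∷ y) p q = h _ _ (proj₁ (∧-elim p)) q
    h′ (true  ∷ x) (true  ∷ y) p q = h _ _ (proj₁ (∧-elim p)) (proj₁ (∧-elim q))
  shift-∪ {suc d} P Q R R↓ h (a ∷ false ∷ x) (b ∷ true ∷ y) p q =
    subst R (∪-swap a b false true x y) (shift-∪ (shift⁻ P) (shift⁺ Q) (R ∘ suc) R↓ h′ (a ∷ x) (b ∷ y) p q)
    where
    h′ : ∀ x y → T (shift⁻ P x) → T (shift⁺ Q y) → R (suc ∣ x ∪ y ∣)
    h′ (false ∷ x) (false ∷ y) p q = [ h _ _ p , h _ _ p ] (∨-elim q)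
    h′ (false ∷ x) (true  ∷ y) p q = h _ _ p q
    h′ (true  ∷ x) (false ∷ y) p q with ∧-elim p
    -- A member that stayed at 10 has 01 beside it in the family. Whichever pattern `y` came from,
    -- the complementary one is available for `x`, so the two initial entries contribute 2 before
    -- the shift as well.
    ... | p₁₀ , p₀₁ = [ h (false ∷ true ∷ x) (true ∷ false ∷ y) p₀₁ , h (true ∷ false ∷ x) (false ∷ true ∷ y) p₁₀ ] (∨-elim q)
    h′ (true  ∷ x) (true  ∷ y) p q = h _ _ (proj₁ (∧-elim p)) q
  shift-∪ {suc d} P Q R R↓ h (a ∷ true ∷ x) (b ∷ false ∷ y) p q =
    subst R (∪-swap a b true false x y) (shift-∪ (shift⁺ P) (shift⁻ Q) (R ∘ suc) R↓ h′ (a ∷ x) (b ∷ y) p q)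
    where
    h′ : ∀ x y → T (shift⁺ P x) → T (shift⁻ Q y) → R (suc ∣ x ∪ y ∣)
    h′ (false ∷ x) (false ∷ y) p q = [ (λ p → h _ _ p q) , (λ p → h _ _ p q) ] (∨-elim p)
    h′ (true  ∷ x) (false ∷ y) p q = h _ _ p q
    h′ (false ∷ x) (true  ∷ y) p q with ∧-elim q
    ... | q₁₀ , q₀₁ = [ (λ p → h (true ∷ false ∷ x) (false ∷ true ∷ y) p q₀₁) , (λ p → h (false ∷ true ∷ x) (true ∷ false ∷ y) p q₁₀) ] (∨-elim p)
    h′ (true  ∷ x) (true  ∷ y) p q = h _ _ p (proj₁ (∧-elim q))
  shift-∪ {suc d} P Q R R↓ h (a ∷ true ∷ x) (b ∷ true ∷ y) p q =
    subst R (∪-swap a b true true x y) (shift-∪ (shift⁺ P) (shift⁺ Q) (R ∘ suc) R↓ h′ (a ∷ x) (b ∷ y) p q)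
    where
    h′ : ∀ x y → T (shift⁺ P x) → T (shift⁺ Q y) → R (suc ∣ x ∪ y ∣)
    h′ (false ∷ x) (false ∷ y) p q with ∨-elim p | ∨-elim q
    ... | inj₁ p₁₀ | inj₁ q₁₀ = h _ _ p₁₀ q₁₀
    ... | inj₁ p₁₀ | inj₂ q₀₁ = R↓ (h _ _ p₁₀ q₀₁)
    ... | inj₂ p₀₁ | inj₁ q₁₀ = R↓ (h _ _ p₀₁ q₁₀)
    ... | inj₂ p₀₁ | inj₂ q₀₁ = h _ _ p₀₁ q₀₁
    h′ (false ∷ x) (true  ∷ y) p q =
      [ (λ p → h (true ∷ false ∷ x) (true ∷ true ∷ y) p q) , (λ p → h (false ∷ true ∷ x) (true ∷ true ∷ y) p q) ] (∨-elim p) 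
    h′ (true  ∷ x) (false ∷ y) p q =
      [ (λ q → h _ _ p q) , (λ q → h _ _ p q) ] (∨-elim q)
    h′ (true  ∷ x) (true  ∷ y) p q = h _ _ p q

  shift-upper : ∀ {d} (P : Family (suc d)) x → T (shift P (true ∷ x)) → T (P (true ∷ x))
  shift-upper P []          p = p
  shift-upper P (false ∷ x) p = proj₁ (∧-elim (shift-upper (shift⁻ P) x p))
  shift-upper P (true  ∷ x) p = shift-upper (shift⁺ P) x p

  shift-lower : ∀ {d} (P : Family (suc d)) x → T (P (false ∷ x)) → T (shift P (false ∷ x))
  shift-lower P []          p = p
  shift-lower P (false ∷ x) p = shift-lower (shift⁻ P) x p
  shift-lower P (true  ∷ x) p = shift-lower (shift⁺ P) x (Equivalence.from T-∨ (inj₂ p))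

  -- A member with head 1 after all steps was never moved, so it was present when the head was
  -- exchanged with coordinate i. That step leaves its target occupied, and the target, having head
  -- 0, is never moved later.
  shift-stable : ∀ {d} (P : Family (suc d)) x i → lookup x i ≡ false →
    T (shift P (true ∷ x)) → T (shift P (false ∷ (x [ i ]≔ true)))
  shift-stable P (false ∷ x) zero    _  p = shift-lower (shift⁺ P) x
    (Equivalence.from (T-∨ {P (true ∷ false ∷ x)})
      (inj₁ (proj₁ (∧-elim {P (true ∷ false ∷ x)} (shift-upper (shift⁻ P) x p)))))
  shift-stable P (false ∷ x) (suc i) eq p = shift-stable (shift⁻ P) x i eq p
  shift-stable P (true  ∷ x) (suc i) eq p = shift-stable (shift⁺ P) x i eq p

  ∪-extend : ∀ {d} (x y : Vec Bool d) → ∣ x ∪ y ∣ < d →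
    ∃[ i ] lookup x i ≡ false × ∣ (x [ i ]≔ true) ∪ y ∣ ≡ suc ∣ x ∪ y ∣
  ∪-extend (false ∷ x) (false ∷ y) _ = zero , refl , refl
  ∪-extend (false ∷ x) (true  ∷ y) (s≤s lt) with ∪-extend x y lt
  ... | i , xᵢ , eq = suc i , xᵢ , cong suc eq
  ∪-extend (true  ∷ x) (b     ∷ y) (s≤s lt) with ∪-extend x y lt
  ... | i , xᵢ , eq = suc i , xᵢ , cong suc eq

  -- Families with small unions.

  ball : ℕ → ℕ → ℕ
  ball t d = card {d} (λ x → ∣ x ∣ ≤ᵇ t)

  ball-suc : ∀ t d → ball (suc t) (suc d) ≡ ball (suc t) d + ball t d
  ball-suc t d = cong (ball (suc t) d +_) (Σᶜ-cong {d} λ x → cong χ (<ᵇ-≤ᵇ ∣ x ∣ t))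
    where
    <ᵇ-≤ᵇ : ∀ a t → (a <ᵇ suc t) ≡ (a ≤ᵇ t)
    <ᵇ-≤ᵇ zero    t = refl
    <ᵇ-≤ᵇ (suc a) t = refl

  ∣x∣+∣∁x∣≡d : ∀ {d} (x : Vec Bool d) → ∣ x ∣ + ∣ ∁ x ∣ ≡ d
  ∣x∣+∣∁x∣≡d []          = refl
  ∣x∣+∣∁x∣≡d (false ∷ x) = trans (+-suc ∣ x ∣ ∣ ∁ x ∣) (cong suc (∣x∣+∣∁x∣≡d x))
  ∣x∣+∣∁x∣≡d (true  ∷ x) = cong suc (∣x∣+∣∁x∣≡d x)

  χ-mono : ∀ {a b} → (T a → T b) → χ a ≤ χ b
  χ-mono {false}         _ = z≤n
  χ-mono {true}  {true}  _ = ≤-refl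
  χ-mono {true}  {false} h = contradiction _ h

  card-∁-≤ : ∀ {d} (P : Family d) → (∀ x → T (P x) → ¬ T (P (∁ x))) → card P + card P ≤ 2 ^ d
  card-∁-≤ {d} P h = begin
    card P + card P                   ≡⟨ cong (card P +_) (Σᶜ-∁ (χ ∘ P)) ⟨
    card P + card (P ∘ ∁)             ≡⟨ Σᶜ-+ (χ ∘ P) (χ ∘ P ∘ ∁) ⟨
    Σᶜ (λ x → χ (P x) + χ (P (∁ x)))  ≤⟨ Σᶜ-mono (λ x → pair (P x) (P (∁ x)) (h x)) ⟩
    Σᶜ {d} (λ _ → 1)                  ≡⟨ Σᶜ-const d 1 ⟩
    2 ^ d * 1                         ≡⟨ *-identityʳ (2 ^ d) ⟩
    2 ^ d                             ∎
    where
    open ≤-Reasoning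
    pair : ∀ a b → (T a → ¬ T b) → χ a + χ b ≤ 1
    pair false b     _ = χ≤1 b
    pair true  false _ = ≤-refl
    pair true  true  h = contradiction _ (h _)

  -- The weights of a vector and its complement add up to 2t + 1, so one of them is at most t.
  2^d≤2ball : ∀ t → 2 ^ suc (2 * t) ≤ ball t (suc (2 * t)) + ball t (suc (2 * t))
  2^d≤2ball t = begin
    2 ^ d                              ≡⟨ *-identityʳ (2 ^ d) ⟨
    2 ^ d * 1                          ≡⟨ Σᶜ-const d 1 ⟨
    Σᶜ {d} (λ _ → 1)                   ≤⟨ Σᶜ-mono small ⟩
    Σᶜ {d} (λ x → χ (∣ x ∣ ≤ᵇ t) + χ (∣ ∁ x ∣ ≤ᵇ t)) ≡⟨ Σᶜ-+ {d} (λ x → χ (∣ x ∣ ≤ᵇ t)) (λ x → χ (∣ ∁ x ∣ ≤ᵇ t)) ⟩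
    ball t d + Σᶜ {d} (λ x → χ (∣ ∁ x ∣ ≤ᵇ t)) ≡⟨ cong (ball t d +_) (Σᶜ-∁ {d} (λ x → χ (∣ x ∣ ≤ᵇ t))) ⟩
    ball t d + ball t d                ∎
    where
    open ≤-Reasoning
    d = suc (2 * t)
    small : ∀ (x : Vec Bool d) → 1 ≤ χ (∣ x ∣ ≤ᵇ t) + χ (∣ ∁ x ∣ ≤ᵇ t)
    small x with ∣ x ∣ ≤? t
    ... | yes p = m≤n⇒m≤n+o _ (χ-mono {true} (λ _ → ≤⇒≤ᵇ p))
    ... | no ¬p = m≤n⇒m≤o+n _ (χ-mono {true} (λ _ → ≤⇒≤ᵇ (+-cancelˡ-≤ (suc t) _ _ (begin
      suc t + ∣ ∁ x ∣  ≤⟨ +-monoˡ-≤ _ (≰⇒> ¬p) ⟩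
      ∣ x ∣ + ∣ ∁ x ∣  ≡⟨ ∣x∣+∣∁x∣≡d x ⟩
      suc (2 * t)      ≡⟨ solve 1 (λ t → con 1 :+ con 2 :* t := con 1 :+ t :+ t) refl t ⟩
      suc t + t        ∎))))

  -- Katona's theorem, for unions instead of intersections.
  katona : ∀ t d → 2 * t < d → (P : Family d) →
    (∀ x y → T (P x) → T (P y) → ∣ x ∪ y ∣ ≤ 2 * t) → card P ≤ ball t d
  katona zero    d       lt P h = Σᶜ-mono λ x → χ-mono λ p →
    ≤⇒≤ᵇ (subst (λ z → ∣ z ∣ ≤ 0) (∪-idem x) (h x x p p))
  katona (suc t) (suc d) lt P h with suc (2 * suc t) ≟ suc d
  -- The dimension exceeds the union bound by exactly one: a member and its complement would have
  -- the full set as union, so the family fills at most half of the cube.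
  ... | yes refl = *-cancelˡ-≤ 2 (begin
    2 * card P                    ≡⟨ cong (card P +_) (+-identityʳ (card P)) ⟩
    card P + card P               ≤⟨ card-∁-≤ P (λ x p q → full x (h x (∁ x) p q)) ⟩
    2 ^ suc d                     ≤⟨ 2^d≤2ball (suc t) ⟩
    b + b                         ≡⟨ cong (b +_) (+-identityʳ b) ⟨
    2 * b                         ∎)
    where
    open ≤-Reasoning
    b = ball (suc t) (suc d)
    full : ∀ (x : Vec Bool (suc d)) → ∣ x ∪ ∁ x ∣ ≰ d
    full x le = n≮n d (subst (_≤ d) (trans (cong ∣_∣ (p∪∁p≡⊤ x)) (∣⊤∣≡n (suc d))) le)
  -- Splitting by the head follows the Pascal rule of `ball-suc`. Dropping the head 1 lowers the
  -- union bound by one only; the second unit needed for parameter t comes from `shift-stable`.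
  ... | no ≢ = begin
    card P                         ≡⟨ card-shift P ⟨
    card P₀ + card P₁              ≤⟨ +-mono-≤ (katona (suc t) d lt′ P₀ h₀) (katona t d lt″ P₁ h₁) ⟩
    ball (suc t) d + ball t d      ≡⟨ ball-suc t d ⟨
    ball (suc t) (suc d)           ∎
    where
    open ≤-Reasoning
    P₀ P₁ : Family d
    P₀ x = shift P (false ∷ x)
    P₁ x = shift P (true ∷ x)
    lt′ : 2 * suc t < d
    lt′ = s≤s⁻¹ (≤∧≢⇒< lt ≢)
    lt″ : 2 * t < d
    lt″ = ≤-<-trans (*-monoʳ-≤ 2 (n≤1+n t)) lt′
    h′ : ∀ x y → T (shift P x) → T (shift P y) → ∣ x ∪ y ∣ ≤ 2 * suc t
    h′ = shift-∪ P P (_≤ 2 * suc t) (≤-trans (n≤1+n _)) h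
    h₀ : ∀ x y → T (P₀ x) → T (P₀ y) → ∣ x ∪ y ∣ ≤ 2 * suc t
    h₀ x y = h′ (false ∷ x) (false ∷ y)
    -- An upper pair with a union of odd size 2t + 1 could be enlarged by
    -- exchanging the head of one of its members for a coordinate outside.
    h₁ : ∀ x y → T (P₁ x) → T (P₁ y) → ∣ x ∪ y ∣ ≤ 2 * t
    h₁ x y p q with ∪-extend x y (<-trans (h′ (true ∷ x) (true ∷ y) p q) lt′)
    ... | i , xᵢ , eq = s≤s⁻¹ (s≤s⁻¹ (begin
      suc (suc ∣ x ∪ y ∣)           ≡⟨ cong suc eq ⟨
      suc ∣ (x [ i ]≔ true) ∪ y ∣   ≤⟨ h′ (false ∷ (x [ i ]≔ true)) (true ∷ y) (shift-stable P x i xᵢ p) q ⟩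
      2 * suc t                     ≡⟨ *-suc 2 t ⟩
      2 + 2 * t                     ∎))

  -- Kleitman's theorem for even and odd diameter.

  kleitman-even : ∀ t d → 2 * t < d → (P : Family d) →
    (∀ x y → T (P x) → T (P y) → ∣ x ⊕ y ∣ ≤ 2 * t) → card P ≤ ball t d
  kleitman-even t d lt P h = subst (_≤ ball t d) (card-down P)
    (katona t d lt (down P) (down-∪ P P (_≤ 2 * t) (≤-trans (n≤1+n _)) h))

  odd : ℕ → Bool
  odd zero    = false
  odd (suc n) = not (odd n)

  weightParity : ∀ {d} → Vec Bool d → Bool
  weightParity []      = false
  weightParity (b ∷ x) = b xor weightParity x

  odd-⊕ : ∀ {d} (x y : Vec Bool d) → odd ∣ x ⊕ y ∣ ≡ weightParity x xor weightParity y
  odd-⊕ []          []          = refl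
  odd-⊕ (false ∷ x) (false ∷ y) = odd-⊕ x y
  odd-⊕ (false ∷ x) (true  ∷ y) = trans (cong not (odd-⊕ x y)) (notʳ (weightParity x) _)
    where
    notʳ : ∀ a b → not (a xor b) ≡ a xor not b
    notʳ false b = refl
    notʳ true  b = refl
  odd-⊕ (true  ∷ x) (false ∷ y) = trans (cong not (odd-⊕ x y)) (notˡ (weightParity x) _)
    where
    notˡ : ∀ a b → not (a xor b) ≡ not a xor b
    notˡ false b = refl
    notˡ true false  = refl
    notˡ true true  = refl
  odd-⊕ (true  ∷ x) (true  ∷ y) = trans (odd-⊕ x y) (not-not (weightParity x) _)
    where
    not-not : ∀ a b → a xor b ≡ not a xor not b
    not-not false false = refl
    not-not false true  = refl
    not-not true  b     = refl

  odd-1+2* : ∀ t → odd (suc (2 * t)) ≡ true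
  odd-1+2* zero    = refl
  odd-1+2* (suc t) = trans (cong (odd ∘ suc) (*-suc 2 t))
    (trans (not-involutive (odd (suc (2 * t)))) (odd-1+2* t))

  -- The two balls are the two classes of weight parity. Within a class the first entry is
  -- determined by the others, so deleting it loses no member.
  kleitman-odd : ∀ t d → suc (2 * t) < suc d → (P : Family (suc d)) →
    (∀ x y → T (P x) → T (P y) → ∣ x ⊕ y ∣ ≤ suc (2 * t)) → card P ≤ ball t d + ball t d
  kleitman-odd t d lt P h = begin
    card P                                    ≡⟨ Σᶜ-+ (λ x → χ (P (false ∷ x))) (λ x → χ (P (true ∷ x))) ⟨
    Σᶜ (λ x → χ (P (false ∷ x)) + χ (P (true ∷ x)))  ≡⟨ Σᶜ-cong (λ x → regroup x (weightParity x)) ⟩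
    Σᶜ (λ x → χ (Q false x) + χ (Q true x))   ≡⟨ Σᶜ-+ (χ ∘ Q false) (χ ∘ Q true) ⟩
    card (Q false) + card (Q true)            ≤⟨ +-mono-≤ (class false) (class true) ⟩
    ball t d + ball t d                       ∎
    where
    open ≤-Reasoning
    -- The members of P whose weight has parity c, without their first entry:
    -- distances within such a class are even before the entry is dropped.
    Q : Bool → Family d
    Q c x = P ((c xor weightParity x) ∷ x)
    regroup : ∀ x b → χ (P (false ∷ x)) + χ (P (true ∷ x)) ≡ χ (P (b ∷ x)) + χ (P (not b ∷ x))
    regroup x false = refl
    regroup x true  = +-comm (χ (P (false ∷ x))) _
    xor-same : ∀ c a b → a xor b ≡ true → (c xor a) xor (c xor b) ≡ true
    xor-same false a     b     e = e
    xor-same true  false true  e = refl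
    xor-same true  true  false e = refl
    heads : ∀ a b (x y : Vec Bool d) → a xor b ≡ true → ∣ (a ∷ x) ⊕ (b ∷ y) ∣ ≡ suc ∣ x ⊕ y ∣
    heads a b x y e rewrite e = refl
    distance : ∀ c x y → T (Q c x) → T (Q c y) → ∣ x ⊕ y ∣ ≤ 2 * t
    -- If the tails were at the odd distance 2t + 1, their weight parities would differ, hence also
    -- the restored heads, and the full distance would be 2t + 2.
    distance c x y p q with ∣ x ⊕ y ∣ ≟ suc (2 * t)
    ... | yes eq = contradiction (h _ _ p q) (<⇒≱ (≤-reflexive (sym (trans
      (heads (c xor weightParity x) (c xor weightParity y) x y (xor-same c (weightParity x) (weightParity y)
        (trans (sym (odd-⊕ x y)) (trans (cong odd eq) (odd-1+2* t)))))
      (cong suc eq)))))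
    ... | no ≢ = s≤s⁻¹ (≤∧≢⇒< (≤-trans (tail (c xor weightParity x) (c xor weightParity y)) (h _ _ p q)) ≢)
      where
      tail : ∀ a b → ∣ x ⊕ y ∣ ≤ ∣ (a ∷ x) ⊕ (b ∷ y) ∣
      tail a b with a xor b
      ... | false = ≤-refl
      ... | true  = n≤1+n _
    class : ∀ c → card (Q c) ≤ ball t d
    class c = kleitman-even t d (s≤s⁻¹ lt) (Q c) (distance c)

  -- Cardinalities of the configurations.

  length-filter-map : ∀ {A B : Set} {P : B → Set} (P? : Decidable P) (f : A → B) xs →
    length (filter P? (List.map f xs)) ≡ length (filter (P? ∘ f) xs)
  length-filter-map P? f List.[] = refl
  length-filter-map P? f (x List.∷ xs) with does (P? (f x))
  ... | false = length-filter-map P? f xs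
  ... | true  = cong suc (length-filter-map P? f xs)

  length-filter-binaryVectors : ∀ d {P : Vec Bool d → Set} (P? : Decidable P) →
    length (filter P? (binaryVectors d)) ≡ card (does ∘ P?)
  length-filter-binaryVectors zero P? with does (P? [])
  ... | false = refl
  ... | true  = refl
  length-filter-binaryVectors (suc d) P?
    rewrite ++-identityʳ (List.map (true ∷_) (binaryVectors d))
          | filter-++ P? (List.map (false ∷_) (binaryVectors d)) (List.map (true ∷_) (binaryVectors d))
          | length-++ (filter P? (List.map (false ∷_) (binaryVectors d)))
                      {filter P? (List.map (true ∷_) (binaryVectors d))}
          | length-filter-map P? (false ∷_) (binaryVectors d)
          | length-filter-map P? (true ∷_) (binaryVectors d)
    = cong₂ _+_ (length-filter-binaryVectors d (P? ∘ (false ∷_)))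
                (length-filter-binaryVectors d (P? ∘ (true ∷_)))

  length-atMostOnes : ∀ t d → length (atMostOnes t d) ≡ ball t d
  length-atMostOnes t d = length-filter-binaryVectors d (λ x → ∣ x ∣ ≤? t)

  length-B-odd : ∀ t d → length (configuration 1ℙ t (suc d)) ≡ ball t d + ball t d
  length-B-odd t d
    rewrite ++-identityʳ (List.map (true ∷_) (atMostOnes t d))
          | length-++ (List.map (false ∷_) (atMostOnes t d)) {List.map (true ∷_) (atMostOnes t d)}
          | length-map (false ∷_) (atMostOnes t d)
          | length-map (true ∷_) (atMostOnes t d)
          | length-atMostOnes t d = refl

  parity-⌊/2⌋ : ∀ m → (parity m ≡ 0ℙ × m ≡ 2 * ⌊ m /2⌋) ⊎ (parity m ≡ 1ℙ × m ≡ suc (2 * ⌊ m /2⌋))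
  parity-⌊/2⌋ zero          = inj₁ (refl , refl)
  parity-⌊/2⌋ (suc zero)    = inj₂ (refl , refl)
  parity-⌊/2⌋ (suc (suc m)) with parity-⌊/2⌋ m
  ... | inj₁ (π , eq) = inj₁ (π , trans (cong (2 +_) eq) (sym (*-suc 2 ⌊ m /2⌋)))
  ... | inj₂ (π , eq) = inj₂ (π , cong suc (trans (cong (suc) eq) (sym (*-suc 2 ⌊ m /2⌋))))

  kleitman : ∀ m d → m < d → (P : Family d) →
    (∀ x y → T (P x) → T (P y) → ∣ x ⊕ y ∣ ≤ m) → card P ≤ length (B m d)
  kleitman m (suc d) lt P h with parity-⌊/2⌋ m
  ... | inj₁ (π , eq) rewrite π | length-atMostOnes ⌊ m /2⌋ (suc d) =
    kleitman-even ⌊ m /2⌋ (suc d) (subst (_< suc d) eq lt) P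
      (λ x y p q → subst (∣ x ⊕ y ∣ ≤_) eq (h x y p q))
  ... | inj₂ (π , eq) rewrite π | length-B-odd ⌊ m /2⌋ d =
    kleitman-odd ⌊ m /2⌋ d (subst (_< suc d) eq lt) P
      (λ x y p q → subst (∣ x ⊕ y ∣ ≤_) eq (h x y p q))

-- Words with jokers, their subcubes and the integer form of the bound.

module Codes where

  open import Data.Bool.Base using (Bool; true; false; T; not; _∧_; _xor_)
  open import Data.Bool.Properties using (T-∧)
  open import Data.Fin.Base as Fin using (Fin; zero; suc; toℕ)
  open import Data.Fin.Properties as Fin using (any?; toℕ-inject₁; toℕ-fromℕ; toℕ<n)
  open import Data.Fin.Subset using (∣_∣; ∁)
  open import Data.Fin.Subset.Properties using (∣p∣≤n)
  open import Data.List.Base using (length)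
  open import Data.Maybe.Base using (Maybe; just; nothing; is-nothing)
  open import Data.Nat.Base
  open import Data.Nat.Properties
  open import Data.Nat.Solver using (module +-*-Solver)
  open import Data.Product.Base using (_×_; _,_; proj₂; ∃-syntax)
  open import Data.Sum.Base using (_⊎_; inj₁; inj₂)
  open import Data.Vec.Base using (Vec; []; _∷_; zipWith; map)
  open import Function.Base using (_∘_)
  open import Function.Bundles using (Equivalence)
  open import Relation.Binary.PropositionalEquality
  open import Relation.Nullary using (T?; does; yes; no; ¬_; contradiction)
  open import Relation.Nullary.Decidable using (dec-true)
  open import Algebra.Properties.CommutativeMonoid.Sum +-0-commutativeMonoid
    using (sum-syntax; sum; sum-cong-≗; ∑-distrib-+; ∑-comm; sum-replicate-zero; sum-init-last)
  open import Algebra.Properties.Semiring.Sum +-*-semiring using (*-distribˡ-sum)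
  open +-*-Solver using (solve; _:+_; _:*_; _:=_; con)
  open Hypercube

  ∑-mono : ∀ {n} {f g : Fin n → ℕ} → (∀ i → f i ≤ g i) → sum f ≤ sum g
  ∑-mono {zero}  f≤g = z≤n
  ∑-mono {suc n} f≤g = +-mono-≤ (f≤g zero) (∑-mono (f≤g ∘ suc))

  ∑-zero : ∀ {n} {f : Fin n → ℕ} → (∀ i → f i ≡ 0) → sum f ≡ 0
  ∑-zero {n} f≡0 = trans (sum-cong-≗ f≡0) (sum-replicate-zero n)

  ∑-const : ∀ n c → ∑[ _ < n ] c ≡ n * c
  ∑-const zero    c = refl
  ∑-const (suc n) c = cong (c +_) (∑-const n c)

  ∑-single : ∀ {n} (f : Fin n → ℕ) v → (∀ u → u ≢ v → f u ≡ 0) → sum f ≡ f v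
  ∑-single f zero    h = trans (cong (f zero +_) (∑-zero (λ u → h (suc u) λ ()))) (+-identityʳ (f zero))
  ∑-single f (suc v) h = cong₂ _+_ (h zero λ ()) (∑-single (f ∘ suc) v (λ u u≢v → h (suc u) (u≢v ∘ Fin.suc-injective)))

  χ-false : ∀ {b} c → ¬ T b → χ b * c ≡ 0
  χ-false {false} c _ = refl
  χ-false {true}  c h = contradiction _ h

  -- Meant for the words whose subcubes contain a given point: disjointness collapses the sum over
  -- all words to the value at the covering word, if there is one.
  ∑-atMostOne : ∀ {n} (p : Fin n → Bool) → (∀ u v → T (p u) → T (p v) → u ≡ v) →
    (∀ (g : Fin n → ℕ) → ∑[ v < n ] (χ (p v) * g v) ≡ 0) ⊎
    (∃[ v ] T (p v) × ∀ (g : Fin n → ℕ) → ∑[ v < n ] (χ (p v) * g v) ≡ g v)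
  ∑-atMostOne p unique with any? (T? ∘ p)
  ... | no none = inj₁ (λ g → ∑-zero (λ v → χ-false (g v) (λ pv → none (v , pv))))
  ... | yes (v , pv) = inj₂ (v , pv , λ g →
    trans (∑-single (λ u → χ (p u) * g u) v (λ u u≢v → χ-false (g u) (λ pu → u≢v (unique u v pu pv))))
          (keep (g v) pv))
    where
    keep : ∀ {b} c → T b → χ b * c ≡ c
    keep {true} c _ = +-identityʳ c

  -- A letter nothing is the joker ∗, so that a word describes a subcube.
  Word : ℕ → Set
  Word d = Vec (Maybe Bool) d

  clash : Maybe Bool → Maybe Bool → Bool
  clash (just a) (just b) = a xor b
  clash _        _        = false

  conflicts : ∀ {d} → Word d → Word d → ℕ
  conflicts v w = ∣ zipWith clash v w ∣

  stars : ∀ {d} → Word d → ℕ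
  stars v = ∣ map is-nothing v ∣

  covers : ∀ {d} → Word d → Family d
  covers []            []      = true
  covers (nothing ∷ v) (_ ∷ x) = covers v x
  covers (just a  ∷ v) (b ∷ x) = not (a xor b) ∧ covers v x

  card-covers : ∀ {d} (v : Word d) → card (covers v) ≡ 2 ^ stars v
  card-covers []                 = refl
  card-covers (nothing    ∷ v)   = trans (cong (λ c → c + c) (card-covers v))
                                         (cong (2 ^ stars v +_) (sym (+-identityʳ _)))
  card-covers {suc d} (just false ∷ v) = trans (cong (card (covers v) +_) (trans (Σᶜ-const d 0) (*-zeroʳ (2 ^ d))))
                                         (trans (+-identityʳ _) (card-covers v))
  card-covers {suc d} (just true  ∷ v) = trans (cong (_+ card (covers v)) (trans (Σᶜ-const d 0) (*-zeroʳ (2 ^ d))))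
                                         (card-covers v)

  ∷-⊕-≤ : ∀ {d} a b (x y : Vec Bool d) → ∣ (a ∷ x) ⊕ (b ∷ y) ∣ ≤ suc ∣ x ⊕ y ∣
  ∷-⊕-≤ a b x y with a xor b
  ... | false = n≤1+n _
  ... | true  = ≤-refl

  -- In a coordinate where the points differ, either the letters clash or one of them is a joker.
  covers-⊕ : ∀ {d} (v w : Word d) x y → T (covers v x) → T (covers w y) →
    ∣ x ⊕ y ∣ ≤ conflicts v w + (stars v + stars w)
  covers-⊕ []            []            []      []      _ _ = z≤n
  covers-⊕ (nothing ∷ v) (nothing ∷ w) (a ∷ x) (b ∷ y) p q = begin
    ∣ (a ∷ x) ⊕ (b ∷ y) ∣  ≤⟨ ∷-⊕-≤ a b x y ⟩
    suc ∣ x ⊕ y ∣          ≤⟨ s≤s (covers-⊕ v w x y p q) ⟩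
    suc (c + (s + t))      ≤⟨ n≤1+n _ ⟩
    suc (suc (c + (s + t))) ≡⟨ solve 3 (λ c s t → con 2 :+ (c :+ (s :+ t)) := c :+ ((con 1 :+ s) :+ (con 1 :+ t))) refl c s t ⟩
    c + (suc s + suc t)    ∎
    where
    open ≤-Reasoning
    c = conflicts v w
    s = stars v
    t = stars w
  covers-⊕ (nothing ∷ v) (just e  ∷ w) (a ∷ x) (b ∷ y) p q = begin
    ∣ (a ∷ x) ⊕ (b ∷ y) ∣  ≤⟨ ∷-⊕-≤ a b x y ⟩
    suc ∣ x ⊕ y ∣          ≤⟨ s≤s (covers-⊕ v w x y p (proj₂ (∧-elim {not (e xor b)} q))) ⟩
    suc (c + (s + t))      ≡⟨ +-suc c (s + t) ⟨
    c + (suc s + t)        ∎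
    where
    open ≤-Reasoning
    c = conflicts v w
    s = stars v
    t = stars w
  covers-⊕ (just e  ∷ v) (nothing ∷ w) (a ∷ x) (b ∷ y) p q = begin
    ∣ (a ∷ x) ⊕ (b ∷ y) ∣  ≤⟨ ∷-⊕-≤ a b x y ⟩
    suc ∣ x ⊕ y ∣          ≤⟨ s≤s (covers-⊕ v w x y (proj₂ (∧-elim {not (e xor a)} p)) q) ⟩
    suc (c + (s + t))      ≡⟨ solve 3 (λ c s t → con 1 :+ (c :+ (s :+ t)) := c :+ (s :+ (con 1 :+ t))) refl c s t ⟩
    c + (s + suc t)        ∎
    where
    open ≤-Reasoning
    c = conflicts v w
    s = stars v
    t = stars w
  covers-⊕ (just false ∷ v) (just false ∷ w) (false ∷ x) (false ∷ y) p q = covers-⊕ v w x y p q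
  covers-⊕ (just false ∷ v) (just true  ∷ w) (false ∷ x) (true  ∷ y) p q = s≤s (covers-⊕ v w x y p q)
  covers-⊕ (just true  ∷ v) (just false ∷ w) (true  ∷ x) (false ∷ y) p q = s≤s (covers-⊕ v w x y p q)
  covers-⊕ (just true  ∷ v) (just true  ∷ w) (true  ∷ x) (true  ∷ y) p q = covers-⊕ v w x y p q

  -- Used contrapositively: a single clash makes two subcubes disjoint.
  covers-both : ∀ {d} (v w : Word d) x → T (covers v x) → T (covers w x) → conflicts v w ≡ 0
  covers-both []                []               []      _ _ = refl
  covers-both (nothing ∷ v)     (nothing ∷ w)    (a ∷ x) p q = covers-both v w x p q
  covers-both (nothing ∷ v)     (just e  ∷ w)    (a ∷ x) p q =
    covers-both v w x p (proj₂ (∧-elim {not (e xor a)} q))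
  covers-both (just e  ∷ v)     (nothing ∷ w)    (a ∷ x) p q =
    covers-both v w x (proj₂ (∧-elim {not (e xor a)} p)) q
  covers-both (just false ∷ v)  (just false ∷ w) (false ∷ x) p q = covers-both v w x p q
  covers-both (just true  ∷ v)  (just true  ∷ w) (true  ∷ x) p q = covers-both v w x p q

  ∣x⊕∁x∣≡d : ∀ {d} (x : Vec Bool d) → ∣ x ⊕ ∁ x ∣ ≡ d
  ∣x⊕∁x∣≡d []          = refl
  ∣x⊕∁x∣≡d (false ∷ x) = cong suc (∣x⊕∁x∣≡d x)
  ∣x⊕∁x∣≡d (true  ∷ x) = cong suc (∣x⊕∁x∣≡d x)

  -- The coefficient 1/2^(j+1) − 1/2^(D−j) of the theorem multiplied by 2^D.
  coeff : ℕ → ℕ → ℕ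
  coeff D j = 2 ^ (D ∸ suc j) ∸ 2 ^ j

  -- The weight that each point in the subcube of a word with s jokers collects from the levels j <
  -- p.
  ∑coeff : ℕ → ℕ → ℕ → ℕ
  ∑coeff D p s = ∑[ j < p ] (coeff D (toℕ j) * χ (s ≤ᵇ toℕ j))

  -- A word with s jokers contributes 2^D to the scaled size of the family, where
  -- D = p + q; residue p q s is what the terms 2^s * coeff D j leave of it.
  residue : ℕ → ℕ → ℕ → ℕ
  residue p q s = 2 ^ (p + (q ⊓ s)) + (2 ^ (p + s) ∸ 2 ^ (s + s))

  z+w≡x+y⇒z≤x+[y∸w] : ∀ {x y z w} → z + w ≡ x + y → z ≤ x + (y ∸ w)
  z+w≡x+y⇒z≤x+[y∸w] {x} {y} {z} {w} eq = +-cancelʳ-≤ w z _ (begin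
    z + w            ≡⟨ eq ⟩
    x + y            ≤⟨ +-monoʳ-≤ x (m≤n+m∸n y w) ⟩
    x + (w + (y ∸ w)) ≡⟨ solve 3 (λ x w u → x :+ (w :+ u) := (x :+ u) :+ w) refl x w (y ∸ w) ⟩
    (x + (y ∸ w)) + w ∎)
    where open ≤-Reasoning

  χ-true : ∀ {b} → T b → χ b ≡ 1
  χ-true {true} _ = refl

  ∑coeff-start : ∀ D s → ∑coeff D s s ≡ 0
  ∑coeff-start D s = ∑-zero λ j → trans (cong (λ b → coeff D (toℕ j) * χ b) (≰⇒≤ᵇ (toℕ<n j))) (*-zeroʳ (coeff D (toℕ j)))
    where
    ≰⇒≤ᵇ : ∀ {j} → j < s → (s ≤ᵇ j) ≡ false
    ≰⇒≤ᵇ {j} j<s with s ≤ᵇ j in eq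
    ... | false = refl
    ... | true  = contradiction (≤ᵇ⇒≤ s j (subst T (sym eq) _)) (<⇒≱ j<s)

  ∑coeff-suc : ∀ D p s → ∑coeff D (suc p) s ≡ ∑coeff D p s + coeff D p * χ (s ≤ᵇ p)
  ∑coeff-suc D p s = trans (sum-init-last {p} (λ j → coeff D (toℕ j) * χ (s ≤ᵇ toℕ j)))
    (cong₂ _+_ (sum-cong-≗ {p} (λ j → cong (λ i → coeff D i * χ (s ≤ᵇ i)) (toℕ-inject₁ j)))
               (cong (λ i → coeff D i * χ (s ≤ᵇ i)) (toℕ-fromℕ p)))

  -- Telescoping: `coeff D m` is the decrease of 2^(D-m) + 2^m from m to m + 1. The bound on s + i
  -- keeps all truncated differences exact.
  ∑coeff-closed : ∀ D s i → (s + i) + (s + i) ≤ D →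
    ∑coeff D (s + i) s + (2 ^ (D ∸ (s + i)) + 2 ^ (s + i)) ≡ 2 ^ (D ∸ s) + 2 ^ s
  ∑coeff-closed D s zero    _  rewrite +-identityʳ s | ∑coeff-start D s = refl
  ∑coeff-closed D s (suc i) le rewrite +-suc s i = begin
    ∑coeff D (suc m) s + (h + 2 ^ suc m)      ≡⟨ cong (_+ (h + 2 ^ suc m)) (∑coeff-suc D m s) ⟩
    E + coeff D m * χ (s ≤ᵇ m) + (h + 2 ^ suc m) ≡⟨ cong (λ c → E + c + (h + 2 ^ suc m)) (trans (cong (coeff D m *_) (χ-true (≤⇒≤ᵇ (m≤m+n s i)))) (*-identityʳ (coeff D m))) ⟩
    E + coeff D m + (h + 2 * 2 ^ m)           ≡⟨ solve 4 (λ e c h b → e :+ c :+ (h :+ con 2 :* b) := e :+ ((c :+ b) :+ h :+ b)) refl E (coeff D m) h (2 ^ m) ⟩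
    E + ((coeff D m + 2 ^ m) + h + 2 ^ m)     ≡⟨ cong (λ c → E + (c + h + 2 ^ m)) (m∸n+n≡m (^-monoʳ-≤ 2 m≤)) ⟩
    E + (h + h + 2 ^ m)                       ≡⟨ cong (λ c → E + (h + c + 2 ^ m)) (+-identityʳ h) ⟨
    E + (2 ^ suc (D ∸ suc m) + 2 ^ m)         ≡⟨ cong (λ e → E + (2 ^ e + 2 ^ m)) (suc-∸ m<D) ⟩
    E + (2 ^ (D ∸ m) + 2 ^ m)                 ≡⟨ ∑coeff-closed D s i (≤-trans (+-mono-≤ (n≤1+n m) (n≤1+n m)) le) ⟩
    2 ^ (D ∸ s) + 2 ^ s                       ∎
    where
    open ≡-Reasoning
    m = s + i
    E = ∑coeff D m s
    h = 2 ^ (D ∸ suc m)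
    m<D : m < D
    m<D = ≤-trans (m≤m+n (suc m) (suc m)) le
    m≤ : m ≤ D ∸ suc m
    m≤ = ≤-trans (n≤1+n m) (m+n≤o⇒m≤o∸n (suc m) le)
    suc-∸ : ∀ {m D} → m < D → suc (D ∸ suc m) ≡ D ∸ m
    suc-∸ {m} {suc D} (s≤s m≤D) = sym (+-∸-assoc 1 m≤D)

  2^s*∑coeff : ∀ p q s → p ≤ q → s ≤ p →
    2 ^ (p + q) + 2 ^ (s + s) ≡ 2 ^ s * ∑coeff (p + q) p s + (2 ^ s * 2 ^ q + 2 ^ s * 2 ^ p)
  2^s*∑coeff p q s p≤q s≤p = begin
    2 ^ D + 2 ^ (s + s)                       ≡⟨ cong₂ _+_ (cong (2 ^_) (sym (m+[n∸m]≡n {s} (m≤n⇒m≤n+o q s≤p)))) refl ⟩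
    2 ^ (s + (D ∸ s)) + 2 ^ (s + s)           ≡⟨ cong₂ _+_ (^-distribˡ-+-* 2 s (D ∸ s)) (^-distribˡ-+-* 2 s s) ⟩
    2 ^ s * 2 ^ (D ∸ s) + 2 ^ s * 2 ^ s       ≡⟨ *-distribˡ-+ (2 ^ s) _ _ ⟨
    2 ^ s * (2 ^ (D ∸ s) + 2 ^ s)             ≡⟨ cong (2 ^ s *_) closed ⟨
    2 ^ s * (E + (2 ^ q + 2 ^ p))             ≡⟨ solve 4 (λ a e b c → a :* (e :+ (b :+ c)) := a :* e :+ (a :* b :+ a :* c)) refl (2 ^ s) E (2 ^ q) (2 ^ p) ⟩
    2 ^ s * E + (2 ^ s * 2 ^ q + 2 ^ s * 2 ^ p) ∎
    where
    open ≡-Reasoning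
    D = p + q
    E = ∑coeff D p s
    closed : E + (2 ^ q + 2 ^ p) ≡ 2 ^ (D ∸ s) + 2 ^ s
    closed = subst₂ (λ m r → ∑coeff D m s + (2 ^ r + 2 ^ m) ≡ 2 ^ (D ∸ s) + 2 ^ s) (m+[n∸m]≡n s≤p)
      (trans (cong (D ∸_) (m+[n∸m]≡n s≤p)) (m+n∸m≡n p q))
      (∑coeff-closed D s (p ∸ s) (subst (λ m → m + m ≤ D) (sym (m+[n∸m]≡n s≤p)) (+-monoʳ-≤ p p≤q)))

  -- For s ≤ p the level terms give (2^p - 2^s)² and the residue is the difference to 4^p. For s > p
  -- the first summand of the residue is already 4^p.
  word-even : ∀ p s → 2 ^ (p + p) ≤ 2 ^ s * ∑coeff (p + p) p s + residue p p s
  word-even p s with s ≤? p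
  ... | no s≰p rewrite m≤n⇒m⊓n≡m (<⇒≤ (≰⇒> s≰p)) = 
    m≤n⇒m≤o+n (2 ^ s * ∑coeff (p + p) p s) (m≤m+n (2 ^ (p + p)) _)
  ... | yes s≤p rewrite m≥n⇒m⊓n≡n s≤p = subst (2 ^ (p + p) ≤_) (+-assoc (2 ^ s * ∑coeff (p + p) p s) _ _)
    (z+w≡x+y⇒z≤x+[y∸w] (trans (2^s*∑coeff p p s ≤-refl s≤p) (trans (sym (+-assoc (2 ^ s * ∑coeff (p + p) p s) (2 ^ s * 2 ^ p) (2 ^ s * 2 ^ p)))
      (cong (λ c → 2 ^ s * ∑coeff (p + p) p s + c + c) 2^s*2^p))))
    where
    2^s*2^p : 2 ^ s * 2 ^ p ≡ 2 ^ (p + s)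
    2^s*2^p = trans (*-comm (2 ^ s) (2 ^ p)) (sym (^-distribˡ-+-* 2 p s))

  -- With q = p + 1 and s ≤ p the closed form leaves 3·2^(p+s) - 4^s, one 2^(p+s) more than the
  -- residue. The level p, taken with weight 2^p, supplies it; this is the origin of the term with B
  -- of index d - 1.
  word-odd : ∀ p s → 2 ^ (p + suc p) ≤
    2 ^ s * ∑coeff (p + suc p) p s + 2 ^ p * (2 ^ s * χ (s ≤ᵇ p)) + residue p (suc p) s
  word-odd p s with s ≤? p
  ... | no s≰p rewrite m≤n⇒m⊓n≡m (≰⇒> s≰p) = 
    m≤n⇒m≤o+n (2 ^ s * ∑coeff (p + suc p) p s + 2 ^ p * (2 ^ s * χ (s ≤ᵇ p))) (m≤m+n (2 ^ (p + suc p)) _)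
  ... | yes s≤p rewrite m≥n⇒m⊓n≡n (m≤n⇒m≤1+n s≤p) | χ-true (≤⇒≤ᵇ s≤p) = begin
    2 ^ (p + suc p)          ≤⟨ z+w≡x+y⇒z≤x+[y∸w] (trans (2^s*∑coeff p (suc p) s (n≤1+n p) s≤p) regroup) ⟩
    E + (c + c) + (c ∸ 2 ^ (s + s)) ≡⟨ cong (λ b → E + (b + c) + (c ∸ 2 ^ (s + s))) (trans (^-distribˡ-+-* 2 p s) (cong (2 ^ p *_) (sym (*-identityʳ (2 ^ s))))) ⟩
    E + (b + c) + (c ∸ 2 ^ (s + s)) ≡⟨ solve 4 (λ e b c u → e :+ (b :+ c) :+ u := e :+ b :+ (c :+ u)) refl E b c (c ∸ 2 ^ (s + s)) ⟩
    E + b + (c + (c ∸ 2 ^ (s + s))) ∎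
    where
    open ≤-Reasoning
    E = 2 ^ s * ∑coeff (p + suc p) p s
    b = 2 ^ p * (2 ^ s * 1)
    c = 2 ^ (p + s)
    regroup : E + (2 ^ s * 2 ^ suc p + 2 ^ s * 2 ^ p) ≡ E + (c + c) + c
    regroup = trans (solve 3 (λ e a b → e :+ (a :* (con 2 :* b) :+ a :* b) := e :+ (b :* a :+ b :* a) :+ b :* a) refl E (2 ^ s) (2 ^ p))
      (cong (λ c → E + (c + c) + c) (sym (^-distribˡ-+-* 2 p s)))

  a+[m∸e]≤m : ∀ {a m e} → a ≤ m → a ≤ e → a + (m ∸ e) ≤ m
  a+[m∸e]≤m {a} {m} {e} a≤m a≤e = ≤-trans (+-monoʳ-≤ a (∸-monoʳ-≤ m a≤e)) (≤-reflexive (m+[n∸m]≡n a≤m))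

  -- Counting a family of pairwise clashing words.

  module _ {k d n : ℕ} (w : Fin n → Word d)
           (separated : ∀ {u v} → u ≢ v → 1 ≤ conflicts (w u) (w v))
           (close : ∀ u v → conflicts (w u) (w v) ≤ k) where

    private
      s : Fin n → ℕ
      s v = stars (w v)

      unique : ∀ x u v → T (covers (w u) x) → T (covers (w v) x) → u ≡ v
      unique x u v p q with u Fin.≟ v
      ... | yes eq = eq
      ... | no ≢ = contradiction (covers-both (w u) (w v) x p q) (λ eq → contradiction (separated ≢) (subst (1 ≰_) (sym eq) λ ()))

    volume : ℕ → ℕ
    volume j = ∑[ v < n ] (2 ^ s v * χ (s v ≤ᵇ j))

    -- Double counting of the pairs of a word and a point of its subcube.
    Σᶜ-covers : ∀ (g : Fin n → ℕ) → Σᶜ (λ x → ∑[ v < n ] (χ (covers (w v) x) * g v)) ≡ ∑[ v < n ] (2 ^ s v * g v)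
    Σᶜ-covers g = trans (Σᶜ-∑ (λ v x → χ (covers (w v) x) * g v))
      (sum-cong-≗ (λ v → trans (Σᶜ-*ʳ (λ x → χ (covers (w v) x)) (g v)) (cong (_* g v) (card-covers (w v)))))

    -- The cubes of the words with at most j jokers form a set of diameter at
    -- most k + 2j.
    volume≤B : ∀ j → k + 2 * j < d → volume j ≤ length (B (k + 2 * j) d)
    volume≤B j lt = begin
      volume j                                                   ≡⟨ Σᶜ-covers (λ v → χ (s v ≤ᵇ j)) ⟨
      Σᶜ (λ x → ∑[ v < n ] (χ (covers (w v) x) * χ (s v ≤ᵇ j)))  ≤⟨ Σᶜ-mono pointwise ⟩
      card P                                                     ≤⟨ kleitman (k + 2 * j) d lt P diameter ⟩
      length (B (k + 2 * j) d)                                   ∎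
      where
      open ≤-Reasoning
      P : Family d
      P x = does (any? (λ v → T? (covers (w v) x ∧ (s v ≤ᵇ j))))
      pointwise : ∀ x → ∑[ v < n ] (χ (covers (w v) x) * χ (s v ≤ᵇ j)) ≤ χ (P x)
      pointwise x with ∑-atMostOne (λ v → covers (w v) x) (unique x)
      ... | inj₁ ≡0 rewrite ≡0 (λ v → χ (s v ≤ᵇ j)) = z≤n
      ... | inj₂ (v , p , ≡g) rewrite ≡g (λ v → χ (s v ≤ᵇ j)) = χ-mono λ q →
        subst T (sym (dec-true (any? _) (v , Equivalence.from (T-∧ {covers (w v) x}) (p , q)))) _
      member : ∀ x → T (P x) → ∃[ v ] T (covers (w v) x) × s v ≤ j
      member x p with any? (λ v → T? (covers (w v) x ∧ (s v ≤ᵇ j)))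
      ... | yes (v , h) with ∧-elim {covers (w v) x} h
      ... | c , l = v , c , ≤ᵇ⇒≤ (s v) j l
      diameter : ∀ x y → T (P x) → T (P y) → ∣ x ⊕ y ∣ ≤ k + 2 * j
      diameter x y p q with member x p | member y q
      ... | u , cu , su | v , cv , sv = begin
        ∣ x ⊕ y ∣                               ≤⟨ covers-⊕ (w u) (w v) x y cu cv ⟩
        conflicts (w u) (w v) + (s u + s v)     ≤⟨ +-mono-≤ (close u v) (+-mono-≤ su sv) ⟩
        k + (j + j)                             ≡⟨ cong (λ i → k + (j + i)) (+-identityʳ j) ⟨
        k + 2 * j                               ∎

    -- Every point x of the cube receives the share α of the word covering x
    -- and the share β of the word covering the antipode of x.  Two such words
    -- have at least d − k jokers together, which keeps the total below 2^d.
    ∑-residue : ∀ p q → p + q + k ≡ d → ∑[ v < n ] residue p q (s v) ≤ 2 ^ (d + p)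
    ∑-residue p q p+q+k≡d = *-cancelˡ-≤ (2 ^ d) {{m^n≢0 2 d}} (begin
      2 ^ d * ∑[ v < n ] residue p q (s v)           ≡⟨ *-distribˡ-sum (2 ^ d) (λ v → residue p q (s v)) ⟩
      ∑[ v < n ] (2 ^ d * residue p q (s v))         ≡⟨ sum-cong-≗ (λ v → share (s v) (∣p∣≤n (map is-nothing (w v)))) ⟨
      ∑[ v < n ] (2 ^ p * (2 ^ s v * α (s v) + 2 ^ s v * β (s v))) ≡⟨ *-distribˡ-sum (2 ^ p) (λ v → 2 ^ s v * α (s v) + 2 ^ s v * β (s v)) ⟨
      2 ^ p * ∑[ v < n ] (2 ^ s v * α (s v) + 2 ^ s v * β (s v)) ≤⟨ *-monoʳ-≤ (2 ^ p) total ⟩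
      2 ^ p * (2 ^ d * 2 ^ d)                        ≡⟨ solve 2 (λ a b → a :* (b :* b) := b :* (b :* a)) refl (2 ^ p) (2 ^ d) ⟩
      2 ^ d * (2 ^ d * 2 ^ p)                        ≡⟨ cong (2 ^ d *_) (^-distribˡ-+-* 2 d p) ⟨
      2 ^ d * 2 ^ (d + p)                            ∎)
      where
      open ≤-Reasoning
      -- In units of 2^d, α is 2^(q-t) capped at 1 and β is the positive part of 1 - 2^(t-p).
      α β : ℕ → ℕ
      α t = 2 ^ ((q ⊓ t) + (d ∸ t))
      β t = 2 ^ d ∸ 2 ^ ((d ∸ p) + t)

      p≤d : p ≤ d
      p≤d = subst (p ≤_) p+q+k≡d (≤-trans (m≤m+n p q) (m≤m+n (p + q) k))

      2^-* : ∀ a b c → 2 ^ a * (2 ^ b * 2 ^ c) ≡ 2 ^ (a + (b + c))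
      2^-* a b c = trans (cong (2 ^ a *_) (sym (^-distribˡ-+-* 2 b c))) (sym (^-distribˡ-+-* 2 a (b + c)))

      share : ∀ t → t ≤ d → 2 ^ p * (2 ^ t * α t + 2 ^ t * β t) ≡ 2 ^ d * residue p q t
      share t t≤d = begin-equality
        2 ^ p * (2 ^ t * α t + 2 ^ t * β t)                ≡⟨ *-distribˡ-+ (2 ^ p) (2 ^ t * α t) (2 ^ t * β t) ⟩
        2 ^ p * (2 ^ t * α t) + 2 ^ p * (2 ^ t * β t)      ≡⟨ cong₂ _+_ α-share β-share ⟩
        2 ^ d * 2 ^ (p + (q ⊓ t)) + 2 ^ d * (2 ^ (p + t) ∸ 2 ^ (t + t)) ≡⟨ *-distribˡ-+ (2 ^ d) _ _ ⟨
        2 ^ d * residue p q t                              ∎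
        where
        α-share : 2 ^ p * (2 ^ t * α t) ≡ 2 ^ d * 2 ^ (p + (q ⊓ t))
        α-share = begin-equality
          2 ^ p * (2 ^ t * α t)                     ≡⟨ 2^-* p t ((q ⊓ t) + (d ∸ t)) ⟩
          2 ^ (p + (t + ((q ⊓ t) + (d ∸ t))))       ≡⟨ cong (2 ^_) (solve 4 (λ p t m e → p :+ (t :+ (m :+ e)) := (t :+ e) :+ (p :+ m)) refl p t (q ⊓ t) (d ∸ t)) ⟩
          2 ^ ((t + (d ∸ t)) + (p + (q ⊓ t)))       ≡⟨ cong (λ e → 2 ^ (e + (p + (q ⊓ t)))) (m+[n∸m]≡n t≤d) ⟩
          2 ^ (d + (p + (q ⊓ t)))                   ≡⟨ ^-distribˡ-+-* 2 d _ ⟩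
          2 ^ d * 2 ^ (p + (q ⊓ t))                 ∎
        β-share : 2 ^ p * (2 ^ t * β t) ≡ 2 ^ d * (2 ^ (p + t) ∸ 2 ^ (t + t))
        β-share = begin-equality
          2 ^ p * (2 ^ t * (2 ^ d ∸ e))             ≡⟨ cong (2 ^ p *_) (*-distribˡ-∸ (2 ^ t) (2 ^ d) e) ⟩
          2 ^ p * (2 ^ t * 2 ^ d ∸ 2 ^ t * e)       ≡⟨ *-distribˡ-∸ (2 ^ p) (2 ^ t * 2 ^ d) (2 ^ t * e) ⟩
          2 ^ p * (2 ^ t * 2 ^ d) ∸ 2 ^ p * (2 ^ t * e) ≡⟨ cong₂ _∸_ first second ⟩
          2 ^ d * 2 ^ (p + t) ∸ 2 ^ d * 2 ^ (t + t) ≡⟨ *-distribˡ-∸ (2 ^ d) (2 ^ (p + t)) (2 ^ (t + t)) ⟨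
          2 ^ d * (2 ^ (p + t) ∸ 2 ^ (t + t))       ∎
          where
          e = 2 ^ ((d ∸ p) + t)
          first : 2 ^ p * (2 ^ t * 2 ^ d) ≡ 2 ^ d * 2 ^ (p + t)
          first = trans (solve 3 (λ a b c → a :* (b :* c) := c :* (a :* b)) refl (2 ^ p) (2 ^ t) (2 ^ d))
            (cong (2 ^ d *_) (sym (^-distribˡ-+-* 2 p t)))
          second : 2 ^ p * (2 ^ t * e) ≡ 2 ^ d * 2 ^ (t + t)
          second = trans (2^-* p t ((d ∸ p) + t)) (trans
            (cong (2 ^_) (trans (solve 3 (λ p t r → p :+ (t :+ (r :+ t)) := (p :+ r) :+ (t :+ t)) refl p t (d ∸ p))
                                (cong (_+ (t + t)) (m+[n∸m]≡n p≤d))))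
            (^-distribˡ-+-* 2 d (t + t)))

      α≤2^d : ∀ t → t ≤ d → α t ≤ 2 ^ d
      α≤2^d t t≤d = ^-monoʳ-≤ 2 (≤-trans (+-monoˡ-≤ (d ∸ t) (m⊓n≤n q t)) (≤-reflexive (m+[n∸m]≡n t≤d)))

      -- From t + t′ ≥ p + q follows 2^(q-t) ≤ 2^(t′-p), which in units of 2^d is what the share β
      -- of t′ leaves free.
      α≤ : ∀ t t′ → t ≤ d → d ≤ k + (t + t′) → α t ≤ 2 ^ ((d ∸ p) + t′)
      α≤ t t′ t≤d d≤ = ^-monoʳ-≤ 2 (≤-trans (+-monoˡ-≤ (d ∸ t) (m⊓n≤m q t)) (+-cancelʳ-≤ (p + t) (q + (d ∸ t)) ((d ∸ p) + t′) (begin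
        q + (d ∸ t) + (p + t)       ≡⟨ solve 4 (λ q e p t → q :+ e :+ (p :+ t) := p :+ q :+ (t :+ e)) refl q (d ∸ t) p t ⟩
        p + q + (t + (d ∸ t))       ≡⟨ cong (p + q +_) (m+[n∸m]≡n t≤d) ⟩
        p + q + d                   ≤⟨ +-monoˡ-≤ d p+q≤ ⟩
        t + t′ + d                  ≡⟨ cong (t + t′ +_) (m+[n∸m]≡n p≤d) ⟨
        t + t′ + (p + (d ∸ p))      ≡⟨ solve 4 (λ t t′ p r → t :+ t′ :+ (p :+ r) := r :+ t′ :+ (p :+ t)) refl t t′ p (d ∸ p) ⟩
        (d ∸ p) + t′ + (p + t)      ∎)))
        where
        p+q≤ : p + q ≤ t + t′
        p+q≤ = +-cancelˡ-≤ k _ _ (begin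
          k + (p + q)    ≡⟨ +-comm k (p + q) ⟩
          p + q + k      ≡⟨ p+q+k≡d ⟩
          d              ≤⟨ d≤ ⟩
          k + (t + t′)   ∎)

      pointwise : ∀ x → ∑[ v < n ] (χ (covers (w v) x) * α (s v)) + ∑[ v < n ] (χ (covers (w v) (∁ x)) * β (s v)) ≤ 2 ^ d
      pointwise x with ∑-atMostOne (λ v → covers (w v) x) (unique x) | ∑-atMostOne (λ v → covers (w v) (∁ x)) (unique (∁ x))
      ... | inj₁ ≡0 | inj₁ ≡0′ rewrite ≡0 (α ∘ s) | ≡0′ (β ∘ s) = z≤n
      ... | inj₁ ≡0 | inj₂ (v , _ , ≡g) rewrite ≡0 (α ∘ s) | ≡g (β ∘ s) = m∸n≤m (2 ^ d) (2 ^ ((d ∸ p) + s v))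
      ... | inj₂ (u , _ , ≡g) | inj₁ ≡0 rewrite ≡g (α ∘ s) | ≡0 (β ∘ s) =
        ≤-trans (≤-reflexive (+-identityʳ _)) (α≤2^d (s u) (∣p∣≤n (map is-nothing (w u))))
      ... | inj₂ (u , cu , ≡g) | inj₂ (v , cv , ≡g′) rewrite ≡g (α ∘ s) | ≡g′ (β ∘ s) =
        a+[m∸e]≤m (α≤2^d (s u) su≤d) (α≤ (s u) (s v) su≤d (begin
          d                                      ≡⟨ ∣x⊕∁x∣≡d x ⟨
          ∣ x ⊕ ∁ x ∣                            ≤⟨ covers-⊕ (w u) (w v) x (∁ x) cu cv ⟩
          conflicts (w u) (w v) + (s u + s v)    ≤⟨ +-monoˡ-≤ _ (close u v) ⟩
          k + (s u + s v)                        ∎))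
        where
        su≤d : s u ≤ d
        su≤d = ∣p∣≤n (map is-nothing (w u))

      total : ∑[ v < n ] (2 ^ s v * α (s v) + 2 ^ s v * β (s v)) ≤ 2 ^ d * 2 ^ d
      total = begin
        ∑[ v < n ] (2 ^ s v * α (s v) + 2 ^ s v * β (s v))   ≡⟨ ∑-distrib-+ (λ v → 2 ^ s v * α (s v)) (λ v → 2 ^ s v * β (s v)) ⟩
        ∑[ v < n ] (2 ^ s v * α (s v)) + ∑[ v < n ] (2 ^ s v * β (s v)) ≡⟨ cong₂ _+_ (Σᶜ-covers (α ∘ s)) (Σᶜ-covers (β ∘ s)) ⟨
        -- Passing to antipodes only permutes the cube, so the β shares can be collected at the
        -- points opposite to their words.
        Σᶜ A + Σᶜ A′                                         ≡⟨ cong (Σᶜ A +_) (Σᶜ-∁ A′) ⟨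
        Σᶜ A + Σᶜ (A′ ∘ ∁)                                   ≡⟨ Σᶜ-+ A (A′ ∘ ∁) ⟨
        Σᶜ (λ x → A x + A′ (∁ x))                            ≤⟨ Σᶜ-mono pointwise ⟩
        Σᶜ {d} (λ _ → 2 ^ d)                                 ≡⟨ Σᶜ-const d (2 ^ d) ⟩
        2 ^ d * 2 ^ d                                        ∎
        where
        A A′ : Vec Bool d → ℕ
        A x = ∑[ v < n ] (χ (covers (w v) x) * α (s v))
        A′ x = ∑[ v < n ] (χ (covers (w v) x) * β (s v))

    ∑-coeff-volume : ∀ D p → ∑[ v < n ] (2 ^ s v * ∑coeff D p (s v)) ≡ ∑[ j < p ] (coeff D (toℕ j) * volume (toℕ j))
    ∑-coeff-volume D p = begin
      ∑[ v < n ] (2 ^ s v * ∑coeff D p (s v))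
        ≡⟨ sum-cong-≗ (λ v → *-distribˡ-sum (2 ^ s v) (λ (j : Fin p) → coeff D (toℕ j) * χ (s v ≤ᵇ toℕ j))) ⟩
      ∑[ v < n ] ∑[ j < p ] (2 ^ s v * (coeff D (toℕ j) * χ (s v ≤ᵇ toℕ j)))
        ≡⟨ ∑-comm {n} {p} (λ v j → 2 ^ s v * (coeff D (toℕ j) * χ (s v ≤ᵇ toℕ j))) ⟩
      ∑[ j < p ] ∑[ v < n ] (2 ^ s v * (coeff D (toℕ j) * χ (s v ≤ᵇ toℕ j)))
        ≡⟨ sum-cong-≗ {p} (λ j → sum-cong-≗ {n} (λ v → solve 3 (λ a b c → a :* (b :* c) := b :* (a :* c)) refl
             (2 ^ s v) (coeff D (toℕ j)) (χ (s v ≤ᵇ toℕ j)))) ⟩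
      ∑[ j < p ] ∑[ v < n ] (coeff D (toℕ j) * (2 ^ s v * χ (s v ≤ᵇ toℕ j)))
        ≡⟨ sum-cong-≗ {p} (λ j → sym (*-distribˡ-sum (coeff D (toℕ j)) (λ v → 2 ^ s v * χ (s v ≤ᵇ toℕ j)))) ⟩
      ∑[ j < p ] (coeff D (toℕ j) * volume (toℕ j)) ∎
      where open ≡-Reasoning

    ∑-coeff-B : ℕ → ℕ → ℕ
    ∑-coeff-B D p = ∑[ j < p ] (coeff D (toℕ j) * length (B (k + 2 * toℕ j) d))

    k+2j<d : ∀ {p q j} → p + q + k ≡ d → j < p → p ≤ q → k + 2 * j < d
    k+2j<d {p} {q} {j} refl j<p p≤q = begin-strict
      k + 2 * j      ≡⟨ solve 2 (λ k j → k :+ con 2 :* j := j :+ j :+ k) refl k j ⟩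
      j + j + k      <⟨ +-monoˡ-< k (+-mono-<-≤ j<p (≤-trans (<⇒≤ j<p) p≤q)) ⟩
      p + q + k      ∎
      where open ≤-Reasoning

    ∑-coeff-volume-≤ : ∀ p q → p ≤ q → p + q + k ≡ d → ∑[ v < n ] (2 ^ s v * ∑coeff (p + q) p (s v)) ≤ ∑-coeff-B (p + q) p
    ∑-coeff-volume-≤ p q p≤q eq = ≤-trans (≤-reflexive (∑-coeff-volume (p + q) p))
      (∑-mono {p} (λ j → *-monoʳ-≤ (coeff (p + q) (toℕ j)) (volume≤B (toℕ j) (k+2j<d eq (toℕ<n j) p≤q))))

    size-even : ∀ p → p + p + k ≡ d → 2 ^ (p + p) * n ≤ ∑-coeff-B (p + p) p + 2 ^ (d + p)
    size-even p eq = begin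
      2 ^ (p + p) * n                         ≡⟨ *-comm (2 ^ (p + p)) n ⟩
      n * 2 ^ (p + p)                         ≡⟨ ∑-const n (2 ^ (p + p)) ⟨
      ∑[ v < n ] (2 ^ (p + p))                ≤⟨ ∑-mono (λ v → word-even p (s v)) ⟩
      ∑[ v < n ] (E v + residue p p (s v))    ≡⟨ ∑-distrib-+ E (λ v → residue p p (s v)) ⟩
      ∑[ v < n ] E v + ∑[ v < n ] residue p p (s v)  ≤⟨ +-mono-≤ (∑-coeff-volume-≤ p p ≤-refl eq) (∑-residue p p eq) ⟩
      ∑-coeff-B (p + p) p + 2 ^ (d + p)       ∎
      where
      open ≤-Reasoning
      E : Fin n → ℕ
      E v = 2 ^ s v * ∑coeff (p + p) p (s v)

    size-odd : ∀ p → p + suc p + k ≡ d →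
      2 ^ (p + suc p) * n ≤ ∑-coeff-B (p + suc p) p + 2 ^ p * length (B (d ∸ 1) d) + 2 ^ (d + p)
    size-odd p eq = begin
      2 ^ (p + suc p) * n                     ≡⟨ *-comm (2 ^ (p + suc p)) n ⟩
      n * 2 ^ (p + suc p)                     ≡⟨ ∑-const n (2 ^ (p + suc p)) ⟨
      ∑[ v < n ] (2 ^ (p + suc p))            ≤⟨ ∑-mono (λ v → word-odd p (s v)) ⟩
      ∑[ v < n ] (E v + V v + residue p (suc p) (s v))    ≡⟨ ∑-distrib-+ (λ v → E v + V v) (λ v → residue p (suc p) (s v)) ⟩
      ∑[ v < n ] (E v + V v) + ∑[ v < n ] residue p (suc p) (s v)  ≡⟨ cong (_+ ∑[ v < n ] residue p (suc p) (s v)) (∑-distrib-+ E V) ⟩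
      ∑[ v < n ] E v + ∑[ v < n ] V v + ∑[ v < n ] residue p (suc p) (s v)
        ≤⟨ +-mono-≤ (+-mono-≤ (∑-coeff-volume-≤ p (suc p) (n≤1+n p) eq) V≤) (∑-residue p (suc p) eq) ⟩
      ∑-coeff-B (p + suc p) p + 2 ^ p * length (B (d ∸ 1) d) + 2 ^ (d + p)  ∎
      where
      open ≤-Reasoning
      E V : Fin n → ℕ
      E v = 2 ^ s v * ∑coeff (p + suc p) p (s v)
      V v = 2 ^ p * (2 ^ s v * χ (s v ≤ᵇ p))
      d≡ : suc (k + 2 * p) ≡ d
      d≡ = trans (solve 2 (λ k p → con 1 :+ (k :+ con 2 :* p) := p :+ (con 1 :+ p) :+ k) refl k p) eq
      V≤ : ∑[ v < n ] V v ≤ 2 ^ p * length (B (d ∸ 1) d)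
      V≤ = begin
        ∑[ v < n ] V v                   ≡⟨ *-distribˡ-sum (2 ^ p) (λ v → 2 ^ s v * χ (s v ≤ᵇ p)) ⟨
        2 ^ p * volume p                 ≤⟨ *-monoʳ-≤ (2 ^ p) (volume≤B p (≤-reflexive d≡)) ⟩
        2 ^ p * length (B (k + 2 * p) d) ≡⟨ cong (λ m → 2 ^ p * length (B m d)) (cong (_∸ 1) d≡) ⟩
        2 ^ p * length (B (d ∸ 1) d)     ∎

-- From neighborly boxes to words.

module Boxes where

  open import Data.Bool.Base using (Bool; true; false; T; not; if_then_else_)
  open import Data.Fin.Base using (Fin; zero; suc)
  open import Data.Fin.Properties as Fin using (any?)
  open import Data.Fin.Subset using (Subset; ∣_∣; _∈_; _∉_)
  open import Data.Fin.Subset.Properties using (∣p∣≡n⇒p≡⊤; ∈⊤; _∈?_)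
  open import Data.Maybe.Base using (Maybe; just; nothing)
  open import Data.Nat.Base as ℕ using (ℕ; zero; suc; _∸_)
  open import Data.Nat.Properties as ℕ using ()
  open import Data.Product.Base using (Σ-syntax; ∃-syntax; _×_; _,_; proj₁; proj₂; swap)
  open import Data.Rational.Base as ℚ using (ℚ; 1ℚ)
  open import Data.Rational.Properties as ℚ using ()
  open import Data.Sum.Base using (_⊎_; inj₁; inj₂)
  open import Data.Vec.Base using (Vec; []; _∷_; lookup; tabulate)
  open import Data.Vec.Properties using (lookup⇒[]=; []=⇒lookup)
  open import Data.Vec.Functional using (Vector)
  open import Function.Base using (_∘_; id)
  open import Function.Bundles using (Equivalence; mk⇔)
  open import Relation.Binary.Definitions using (tri<; tri≈; tri>)
  open import Relation.Binary.PropositionalEquality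
  open import Relation.Nullary using (Dec; does; yes; no; ¬_; contradiction)
  open import Relation.Nullary.Decidable using (_×-dec_)
  open Codes
  open ℝ

  Lower-≤ : ∀ x {q r} → q ℚ.≤ r → Lower x r → Lower x q
  Lower-≤ x {q} {r} q≤r l with ℚ.<-cmp q r
  ... | tri< q<r _ _ = Equivalence.from (lower-rounded x q) (r , q<r , l)
  ... | tri≈ _ refl _ = l
  ... | tri> _ _ q>r = contradiction (ℚ.<-≤-trans q>r q≤r) (ℚ.<-irrefl refl)

  Upper-≤ : ∀ x {q r} → q ℚ.≤ r → Upper x q → Upper x r
  Upper-≤ x {q} {r} q≤r u with ℚ.<-cmp q r
  ... | tri< q<r _ _ = Equivalence.from (upper-rounded x r) (q , q<r , u)
  ... | tri≈ _ refl _ = u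
  ... | tri> _ _ q>r = contradiction (ℚ.<-≤-trans q>r q≤r) (ℚ.<-irrefl refl)

  Lower<Upper : ∀ x {q r} → Lower x q → Upper x r → q ℚ.< r
  Lower<Upper x {q} {r} l u with q ℚ.<? r
  ... | yes q<r = q<r
  ... | no q≮r  = contradiction (Lower-≤ x (ℚ.≮⇒≥ q≮r) l , u) (disjoint x r)

  -- The order is defined by lower cuts; locatedness just below q transfers it to upper cuts.
  ≤ᴿ⇒Upper : ∀ x y {q} → x ≤ᴿ y → Upper y q → Upper x q
  ≤ᴿ⇒Upper x y {q} x≤y u with Equivalence.to (upper-rounded y q) u
  ... | p , p<q , u′ with located x p<q
  ... | inj₁ l = contradiction (x≤y l , u′) (disjoint y p)
  ... | inj₂ h = h

  <ᴿ-≤ᴿ-trans : ∀ x y z → x <ᴿ y → y ≤ᴿ z → x <ᴿ z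
  <ᴿ-≤ᴿ-trans x y z (q , u , l) y≤z = q , u , y≤z l

  ≤ᴿ-<ᴿ-trans : ∀ x y z → x ≤ᴿ y → y <ᴿ z → x <ᴿ z
  ≤ᴿ-<ᴿ-trans x y z x≤y (q , u , l) = q , ≤ᴿ⇒Upper x y x≤y u , l

  <ᴿ-irrefl : ∀ x → ¬ (x <ᴿ x)
  <ᴿ-irrefl x (q , u , l) = disjoint x q (l , u)

  -- A constructive replacement for trichotomy: z is located with respect to two rationals between x
  -- and y.
  <ᴿ-cotrans : ∀ x y z → x <ᴿ y → x <ᴿ z ⊎ z <ᴿ y
  <ᴿ-cotrans x y z (q , u , l) with Equivalence.to (lower-rounded y q) l
  ... | r , q<r , l′ with located z q<r
  ... | inj₁ lz = inj₁ (q , u , lz)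
  ... | inj₂ uz = inj₂ (r , uz , l′)

  common-between : ∀ x u v → x <ᴿ u → x <ᴿ v → ∃[ r ] Upper x r × Lower u r × Lower v r
  common-between x u v (q , xq , qu) (r , xr , rv) with ℚ.≤-total q r
  ... | inj₁ q≤r = q , xq , qu , Lower-≤ v q≤r rv
  ... | inj₂ r≤q = r , xr , Lower-≤ u r≤q qu , rv

  rational : ℚ → ℝ
  rational x = record
    { Lower           = ℚ._< x
    ; Upper           = x ℚ.<_
    ; lower-inhabited = x ℚ.+ ℚ.- 1ℚ , subst (x ℚ.+ ℚ.- 1ℚ ℚ.<_) (ℚ.+-identityʳ x) (ℚ.+-monoʳ-< x (ℚ.negative⁻¹ (ℚ.- 1ℚ)))
    ; upper-inhabited = x ℚ.+ 1ℚ , subst (ℚ._< x ℚ.+ 1ℚ) (ℚ.+-identityʳ x) (ℚ.+-monoʳ-< x (ℚ.positive⁻¹ 1ℚ))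
    ; lower-rounded   = λ q → mk⇔ ℚ.<-dense λ (r , q<r , r<x) → ℚ.<-trans q<r r<x
    ; upper-rounded   = λ r → mk⇔ (λ x<r → let (q , x<q , q<r) = ℚ.<-dense x<r in q , q<r , x<q)
                                  (λ (q , q<r , x<q) → ℚ.<-trans x<q q<r)
    ; disjoint        = λ q (q<x , x<q) → ℚ.<-asym q<x x<q
    ; located         = locate
    }
    where
    locate : ∀ {q r} → q ℚ.< r → q ℚ.< x ⊎ x ℚ.< r
    locate {q} q<r with q ℚ.<? x
    ... | yes q<x = inj₁ q<x
    ... | no q≮x  = inj₂ (ℚ.≤-<-trans (ℚ.≮⇒≥ q≮x) q<r)

  -- If the sides overlapped, the intersection would contain two points that
  -- differ only in direction i, in which M has no extent.
  degenerate⇒no-overlap : ∀ {d} (K L M : Box d) → (∀ x → ⟦ K ⟧ x × ⟦ L ⟧ x → ⟦ M ⟧ x) →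
    (∀ x → ⟦ M ⟧ x → ⟦ K ⟧ x × ⟦ L ⟧ x) → ∀ i →
    Box.lo K i <ᴿ Box.hi K i → Box.lo L i <ᴿ Box.hi L i → Box.hi M i ≤ᴿ Box.lo M i →
    ¬ (Box.lo K i <ᴿ Box.hi L i × Box.lo L i <ᴿ Box.hi K i)
  degenerate⇒no-overlap {d} K L M to from i K< L< M≥ (KL , LK)
    with common-between (Box.lo K i) (Box.hi K i) (Box.hi L i) K< KL
       | common-between (Box.lo L i) (Box.hi K i) (Box.hi L i) LK L<
  ... | r₁ , Kr₁ , r₁K , r₁L | r₂ , Lr₂ , r₂K , r₂L = spread q
    where
    q : ∃[ r ] Upper (Box.lo K i) r × Upper (Box.lo L i) r × Lower (Box.hi K i) r × Lower (Box.hi L i) r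
    -- Both candidates lie below the two upper ends, and the larger one lies above the two lower
    -- ends.
    q with ℚ.≤-total r₁ r₂
    ... | inj₁ r₁≤r₂ = r₂ , Upper-≤ (Box.lo K i) r₁≤r₂ Kr₁ , Lr₂ , r₂K , r₂L
    ... | inj₂ r₂≤r₁ = r₁ , Kr₁ , Upper-≤ (Box.lo L i) r₂≤r₁ Lr₂ , r₁K , r₁L
    corner : ⟦ K ⟧ (Box.lo M) × ⟦ L ⟧ (Box.lo M)
    corner = from (Box.lo M) (λ j → id , Box.lo≤hi M j)
    point : ℚ → Vector ℝ d
    point r j = if does (j Fin.≟ i) then rational r else Box.lo M j
    point-i : ∀ r → point r i ≡ rational r
    point-i r with i Fin.≟ i
    ... | yes _ = refl
    ... | no ≢  = contradiction refl ≢
    inside : ∀ (N : Box d) r → ⟦ N ⟧ (Box.lo M) → Upper (Box.lo N i) r → Lower (Box.hi N i) r → ⟦ N ⟧ (point r)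
    inside N r c u l j with j Fin.≟ i
    ... | yes refl = (λ l′ → Lower<Upper (Box.lo N i) l′ u) , (λ s<r → Lower-≤ (Box.hi N i) (ℚ.<⇒≤ s<r) l)
    ... | no _     = c j
    spread : ∃[ r ] Upper (Box.lo K i) r × Upper (Box.lo L i) r × Lower (Box.hi K i) r × Lower (Box.hi L i) r → _
    spread (q , Kq , Lq , qK , qL)
      with common-between (rational q) (Box.hi K i) (Box.hi L i)
             (Equivalence.to (lower-rounded (Box.hi K i) q) qK) (Equivalence.to (lower-rounded (Box.hi L i) q) qL)
    -- Both points belong to `M`, so in direction i its ends satisfy q′ ≤ hi ≤ lo ≤ q; since q < q′,
    -- this yields q < q.
    ... | q′ , q<q′ , q′K , q′L = ℚ.<-irrefl refl
      (subst (λ x → Lower x q) (point-i q) (proj₁ (M∋ q Kq Lq qK qL i) (M≥ (proj₂ (M∋ q′ (Upper-≤ (Box.lo K i) (ℚ.<⇒≤ q<q′) Kq) (Upper-≤ (Box.lo L i) (ℚ.<⇒≤ q<q′) Lq) q′K q′L i)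
        (subst (λ x → Lower x q) (sym (point-i q′)) q<q′)))))
      where
      M∋ : ∀ r → Upper (Box.lo K i) r → Upper (Box.lo L i) r → Lower (Box.hi K i) r → Lower (Box.hi L i) r → ⟦ M ⟧ (point r)
      M∋ r a b c e = to (point r) (inside K r (proj₁ corner) a c , inside L r (proj₂ corner) b e)

  conflicts-tabulate : ∀ {d} (f g : Fin d → Maybe Bool) (S : Subset d) →
    (∀ i → clash (f i) (g i) ≡ not (lookup S i)) → conflicts (tabulate f) (tabulate g) ℕ.+ ∣ S ∣ ≡ d
  conflicts-tabulate {zero} f g [] h = refl
  conflicts-tabulate {suc d} f g (b ∷ S) h rewrite h zero with b
  ... | false = cong suc (conflicts-tabulate (f ∘ suc) (g ∘ suc) S (h ∘ suc))
  ... | true  = trans (ℕ.+-suc _ ∣ S ∣) (cong suc (conflicts-tabulate (f ∘ suc) (g ∘ suc) S (h ∘ suc)))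

  conflicts-self : ∀ {d} (v : Word d) → conflicts v v ≡ 0
  conflicts-self []               = refl
  conflicts-self (nothing ∷ v)    = conflicts-self v
  conflicts-self (just false ∷ v) = conflicts-self v
  conflicts-self (just true ∷ v)  = conflicts-self v

  -- One coordinate direction: letters from touching intervals.

  module Side {m : ℕ} (lo hi : Fin m → ℝ) (proper : ∀ a → lo a <ᴿ hi a)
              (meet : ∀ a b → ¬ (hi a <ᴿ lo b))
              (touching? : ∀ a b → Dec (¬ (lo a <ᴿ hi b × lo b <ᴿ hi a))) where

    Touching : Fin m → Fin m → Set
    Touching a b = ¬ (lo a <ᴿ hi b × lo b <ᴿ hi a)

    -- A rational point inside the side of box a; comparing such points decides
    -- on which side of a common end point each of two touching intervals lies.
    mid : Fin m → ℚ
    mid a = proj₁ (proper a)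

    LeftOf : Fin m → Fin m → Set
    LeftOf a b = Touching a b × mid a ℚ.< mid b

    leftOf? : ∀ a b → Dec (LeftOf a b)
    leftOf? a b = touching? a b ×-dec (mid a ℚ.<? mid b)

    -- The larger inner point `mid b` witnesses `lo a <ᴿ hi b`, so touching refutes the other
    -- inequality.
    leftOf⇒≮ : ∀ {a b} → LeftOf a b → ¬ (lo b <ᴿ hi a)
    leftOf⇒≮ {a} {b} (t , a<b) b<a = t
      ((mid b , Upper-≤ (lo a) (ℚ.<⇒≤ a<b) (proj₁ (proj₂ (proper a))) , proj₂ (proj₂ (proper b))) , b<a)

    -- The chain hi a ≤ lo a′ ≤ hi b′ ≤ lo b, whose middle link holds because `a′` and `b′` meet. It
    -- is read backwards through cotransitivity.
    no-crossing : ∀ {a a′ b b′} → LeftOf a a′ → LeftOf b′ b → ¬ (lo b <ᴿ hi a)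
    no-crossing {a} {a′} {b} {b′} aa′ b′b lt with <ᴿ-cotrans (lo b) (hi a) (hi b′) lt
    ... | inj₁ lt′ = leftOf⇒≮ b′b lt′
    ... | inj₂ lt′ with <ᴿ-cotrans (hi b′) (hi a) (lo a′) lt′
    ... | inj₁ gap = meet b′ a′ gap
    ... | inj₂ lt″ = leftOf⇒≮ aa′ lt″

    -- By `no-crossing` all touchings in this direction happen at one common point. The letter
    -- records the side of that point on which the interval lies; the joker marks an interval that
    -- touches no other.
    letter : Fin m → Maybe Bool
    letter a with any? (leftOf? a) | any? (λ b → leftOf? b a)
    ... | yes _ | _     = just false
    ... | no _  | yes _ = just true
    ... | no _  | no _  = nothing

    letter-left : ∀ {a b} → LeftOf a b → letter a ≡ just false
    letter-left {a} {b} ab with any? (leftOf? a) | any? (λ b → leftOf? b a)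
    ... | yes _ | _ = refl
    ... | no ∄  | _ = contradiction (b , ab) ∄

    letter-right : ∀ {a b} → LeftOf b a → letter a ≡ just true
    letter-right {a} {b} ba with any? (leftOf? a) | any? (λ b → leftOf? b a)
    -- Here `no-crossing` is applied with `a` in both roles: an interval touched at both ends would
    -- have no extent.
    ... | yes (c , ac) | _     = contradiction (proper a) (no-crossing ac ba)
    ... | no _         | yes _ = refl
    ... | no _         | no ∄  = contradiction (b , ba) ∄

    letter-false : ∀ {a} → letter a ≡ just false → ∃[ b ] LeftOf a b
    letter-false {a} eq with any? (leftOf? a) | any? (λ b → leftOf? b a) | eq
    ... | yes ∃ | _     | _  = ∃
    ... | no _  | yes _ | ()
    ... | no _  | no _  | ()

    letter-true : ∀ {a} → letter a ≡ just true → ∃[ b ] LeftOf b a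
    letter-true {a} eq with any? (leftOf? a) | any? (λ b → leftOf? b a) | eq
    ... | yes _ | _     | ()
    ... | no _  | yes ∃ | _  = ∃
    ... | no _  | no _  | ()

    touching⇒clash : ∀ a b → Touching a b → clash (letter a) (letter b) ≡ true
    touching⇒clash a b t with ℚ.<-cmp (mid a) (mid b)
    ... | tri< a<b _ _ = cong₂ clash (letter-left (t , a<b)) (letter-right (t , a<b))
    ... | tri> _ _ b<a = cong₂ clash (letter-right (t ∘ swap , b<a)) (letter-left (t ∘ swap , b<a))
    -- A common inner point makes the intervals overlap.
    ... | tri≈ _ a≡b _ = contradiction
      ( (mid a , proj₁ (proj₂ (proper a)) , subst (Lower (hi b)) (sym a≡b) (proj₂ (proj₂ (proper b))))
      , (mid b , proj₁ (proj₂ (proper b)) , subst (Lower (hi a)) a≡b (proj₂ (proj₂ (proper a)))) ) t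

    -- Opposite letters may stem from touchings with other intervals, yet by `no-crossing` they
    -- still exclude an overlap of `a` and `b`.
    overlapping⇒¬clash : ∀ a b → lo a <ᴿ hi b → lo b <ᴿ hi a → clash (letter a) (letter b) ≡ false
    overlapping⇒¬clash a b a<b b<a with letter a in eqa | letter b in eqb
    ... | nothing    | _          = refl
    ... | just _     | nothing    = refl
    ... | just false | just false = refl
    ... | just true  | just true  = refl
    ... | just false | just true  = contradiction b<a
      (no-crossing (proj₂ (letter-false eqa)) (proj₂ (letter-true eqb)))
    ... | just true  | just false = contradiction a<b
      (no-crossing (proj₂ (letter-false eqb)) (proj₂ (letter-true eqa)))

  -- The code of a neighborly family.

  module _ {k d m : ℕ} (1≤d : 1 ℕ.≤ d) (F : NeighborlyFamily k d m) where

    open NeighborlyFamily F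

    private
      lo hi : Fin m → Fin d → ℝ
      lo a = Box.lo (box a)
      hi a = Box.hi (box a)

    proper : ∀ a i → lo a i <ᴿ hi a i
    proper a i with full a
    ... | S , ∣S∣≡d , nondegenerate , _ = nondegenerate (subst (i ∈_) (sym (∣p∣≡n⇒p≡⊤ ∣S∣≡d)) ∈⊤)

    -- The set S comes from the dimension of the intersection. Both extreme corners of the
    -- intersection lie in both boxes, which gives overlap inside S and excludes gaps everywhere.
    overlapSet : ∀ {a b} → a ≢ b → Σ[ S ∈ Subset d ] d ∸ k ℕ.≤ ∣ S ∣ × ∣ S ∣ ℕ.≤ d ∸ 1
      × (∀ {i} → i ∈ S → lo a i <ᴿ hi b i × lo b i <ᴿ hi a i)
      × (∀ {i} → i ∉ S → ¬ (lo a i <ᴿ hi b i × lo b i <ᴿ hi a i))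
      × (∀ i → ¬ (hi a i <ᴿ lo b i))
    overlapSet {a} {b} a≢b with neighborly a b a≢b
    ... | e , d∸k≤e , e≤d∸1 , M , (A⊆M , M⊆A) , S , refl , nondegenerate , degenerate =
      S , d∸k≤e , e≤d∸1 , inS , outS , meet
      where
      low : ⟦ box a ⟧ (Box.lo M) × ⟦ box b ⟧ (Box.lo M)
      low = M⊆A {Box.lo M} (λ j → id , Box.lo≤hi M j)
      high : ⟦ box a ⟧ (Box.hi M) × ⟦ box b ⟧ (Box.hi M)
      high = M⊆A {Box.hi M} (λ j → Box.lo≤hi M j , id)
      inS : ∀ {i} → i ∈ S → lo a i <ᴿ hi b i × lo b i <ᴿ hi a i
      inS {i} i∈S =
        ≤ᴿ-<ᴿ-trans (lo a i) (Box.lo M i) (hi b i) (proj₁ (proj₁ low i))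
          (<ᴿ-≤ᴿ-trans (Box.lo M i) (Box.hi M i) (hi b i) (nondegenerate i∈S) (proj₂ (proj₂ high i))) ,
        ≤ᴿ-<ᴿ-trans (lo b i) (Box.lo M i) (hi a i) (proj₁ (proj₂ low i))
          (<ᴿ-≤ᴿ-trans (Box.lo M i) (Box.hi M i) (hi a i) (nondegenerate i∈S) (proj₂ (proj₁ high i)))
      outS : ∀ {i} → i ∉ S → ¬ (lo a i <ᴿ hi b i × lo b i <ᴿ hi a i)
      outS {i} i∉S = degenerate⇒no-overlap (box a) (box b) M (λ x → A⊆M {x}) (λ x → M⊆A {x}) i
        (proper a i) (proper b i) (proj₂ (degenerate i∉S))
      meet : ∀ i → ¬ (hi a i <ᴿ lo b i)
      meet i gap = <ᴿ-irrefl (Box.lo M i) (≤ᴿ-<ᴿ-trans (Box.lo M i) (hi a i) (Box.lo M i) (proj₂ (proj₁ low i))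
        (<ᴿ-≤ᴿ-trans (hi a i) (lo b i) (Box.lo M i) gap (proj₁ (proj₂ low i))))

    private
      meet : ∀ i a b → ¬ (hi a i <ᴿ lo b i)
      meet i a b with a Fin.≟ b
      ... | no a≢b  = let (_ , _ , _ , _ , _ , meets) = overlapSet a≢b in meets i
      ... | yes refl = λ gap → <ᴿ-irrefl (lo a i) (≤ᴿ-<ᴿ-trans (lo a i) (hi a i) (lo a i) (Box.lo≤hi (box a) i) gap)

      -- The order of the reals is not decidable, but membership in the finite set that witnesses
      -- the dimension is.
      touching? : ∀ i a b → Dec (¬ (lo a i <ᴿ hi b i × lo b i <ᴿ hi a i))
      touching? i a b with a Fin.≟ b
      ... | yes refl = no λ t → t (proper a i , proper a i)
      ... | no a≢b with overlapSet a≢b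
      ... | S , _ , _ , inS , outS , _ with i ∈? S
      ... | yes i∈S = no λ t → t (inS i∈S)
      ... | no i∉S  = yes (outS i∉S)

      module S (i : Fin d) = Side (λ a → lo a i) (λ a → hi a i) (λ a → proper a i) (meet i) (touching? i)

    code : Fin m → Word d
    code a = tabulate (λ i → S.letter i a)

    code-conflicts : ∀ {a b} → a ≢ b →
      ∃[ e ] d ∸ k ℕ.≤ e × e ℕ.≤ d ∸ 1 × conflicts (code a) (code b) ℕ.+ e ≡ d
    code-conflicts {a} {b} a≢b with overlapSet a≢b
    ... | S , d∸k≤ , ≤d∸1 , inS , outS , _ = ∣ S ∣ , d∸k≤ , ≤d∸1 , conflicts-tabulate _ _ S clashes
      where
      clashes : ∀ i → clash (S.letter i a) (S.letter i b) ≡ not (lookup S i)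
      clashes i with lookup S i in eq
      ... | true  = let (a<b , b<a) = inS (lookup⇒[]= i S eq) in S.overlapping⇒¬clash i a b a<b b<a
      ... | false = S.touching⇒clash i a b (outS (λ i∈S → contradiction (trans (sym eq) ([]=⇒lookup i∈S)) λ ()))

    code-separated : ∀ {a b} → a ≢ b → 1 ℕ.≤ conflicts (code a) (code b)
    code-separated {a} {b} a≢b with code-conflicts a≢b
    ... | e , _ , e≤d∸1 , eq with conflicts (code a) (code b)
    ... | suc _ = ℕ.s≤s ℕ.z≤n
    -- Without a clash the dimension e would be d, contradicting e ≤ d ∸ 1; as 0 ∸ 1 is 0, this
    -- takes d ≥ 1.
    ... | zero  = contradiction (subst (ℕ._≤ d ∸ 1) eq e≤d∸1) (ℕ.<⇒≱ (ℕ.∸-monoʳ-< {d} {1} {0} (ℕ.s≤s ℕ.z≤n) 1≤d))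

    code-close : ∀ a b → conflicts (code a) (code b) ℕ.≤ k
    code-close a b with a Fin.≟ b
    ... | yes refl = subst (ℕ._≤ k) (sym (conflicts-self (code a))) ℕ.z≤n
    ... | no a≢b with code-conflicts a≢b
    ... | e , d∸k≤e , _ , eq = ℕ.+-cancelʳ-≤ e _ k (begin
      conflicts (code a) (code b) ℕ.+ e   ≡⟨ eq ⟩
      d                                   ≤⟨ ℕ.m≤n+m∸n d k ⟩
      k ℕ.+ (d ∸ k)                       ≤⟨ ℕ.+-monoʳ-≤ k d∸k≤e ⟩
      k ℕ.+ e                             ∎)
      where open ℕ.≤-Reasoning

-- Back from scaled natural numbers to rationals.

module Scaling where

  open import Data.Fin.Base using (Fin; zero; suc; toℕ)
  open import Data.Fin.Properties using (toℕ<n)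
  open import Data.Integer.Base as ℤ using (+_)
  import Data.Integer.Properties as ℤ
  open import Data.Nat.Base as ℕ using (ℕ; zero; suc; _∸_; _^_)
  import Data.Nat.Properties as ℕ
  open import Data.Rational.Base
  open import Data.Rational.Properties
  open import Data.Rational.Solver using (module +-*-Solver)
  open import Data.Rational.Unnormalised.Base as ℚᵘ using (mkℚᵘ; *≡*; *≤*)
  import Data.Rational.Unnormalised.Properties as ℚᵘ
  open import Function.Base using (_∘_)
  open import Relation.Binary.PropositionalEquality
  open import Algebra.Properties.CommutativeMonoid.Sum ℕ.+-0-commutativeMonoid as Σℕ using ()
  open import Algebra.Properties.CommutativeMonoid.Sum +-0-commutativeMonoid as Σℚ using (sum-syntax)
  open +-*-Solver using (solve; _:+_; _:*_; _:-_; _:=_)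
  open Codes using (coeff)

  -- Division in ℚ normalises; identities are therefore checked on unnormalised fractions.
  toℚᵘ-fromℕ : ∀ n → toℚᵘ (fromℕ n) ℚᵘ.≃ mkℚᵘ (+ n) 0
  toℚᵘ-fromℕ n = toℚᵘ-fromℚᵘ (mkℚᵘ (+ n) 0)

  fromℕ-+ : ∀ a b → fromℕ (a ℕ.+ b) ≡ fromℕ a + fromℕ b
  fromℕ-+ a b = toℚᵘ-injective (begin
    toℚᵘ (fromℕ (a ℕ.+ b))                    ≈⟨ toℚᵘ-fromℕ (a ℕ.+ b) ⟩
    mkℚᵘ (+ (a ℕ.+ b)) 0                      ≈⟨ *≡* (cong (ℤ._* + 1) (sym (cong₂ ℤ._+_ (ℤ.*-identityʳ (+ a)) (ℤ.*-identityʳ (+ b))))) ⟩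
    mkℚᵘ (+ a) 0 ℚᵘ.+ mkℚᵘ (+ b) 0            ≈⟨ ℚᵘ.+-cong (toℚᵘ-fromℕ a) (toℚᵘ-fromℕ b) ⟨
    toℚᵘ (fromℕ a) ℚᵘ.+ toℚᵘ (fromℕ b)        ≈⟨ toℚᵘ-homo-+ (fromℕ a) (fromℕ b) ⟨
    toℚᵘ (fromℕ a + fromℕ b)                  ∎)
    where open ℚᵘ.≃-Reasoning

  fromℕ-* : ∀ a b → fromℕ (a ℕ.* b) ≡ fromℕ a * fromℕ b
  fromℕ-* a b = toℚᵘ-injective (begin
    toℚᵘ (fromℕ (a ℕ.* b))                    ≈⟨ toℚᵘ-fromℕ (a ℕ.* b) ⟩
    mkℚᵘ (+ (a ℕ.* b)) 0                      ≈⟨ *≡* (cong (ℤ._* + 1) (ℤ.pos-* a b)) ⟩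
    mkℚᵘ (+ a) 0 ℚᵘ.* mkℚᵘ (+ b) 0            ≈⟨ ℚᵘ.*-cong (toℚᵘ-fromℕ a) (toℚᵘ-fromℕ b) ⟨
    toℚᵘ (fromℕ a) ℚᵘ.* toℚᵘ (fromℕ b)        ≈⟨ toℚᵘ-homo-* (fromℕ a) (fromℕ b) ⟨
    toℚᵘ (fromℕ a * fromℕ b)                  ∎)
    where open ℚᵘ.≃-Reasoning

  fromℕ-mono : ∀ {a b} → a ℕ.≤ b → fromℕ a ≤ fromℕ b
  fromℕ-mono {a} {b} a≤b = toℚᵘ-cancel-≤ (begin
    toℚᵘ (fromℕ a)  ≃⟨ toℚᵘ-fromℕ a ⟩
    mkℚᵘ (+ a) 0    ≤⟨ *≤* (ℤ.*-monoʳ-≤-nonNeg (+ 1) (ℤ.+≤+ a≤b)) ⟩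
    mkℚᵘ (+ b) 0    ≃⟨ toℚᵘ-fromℕ b ⟨
    toℚᵘ (fromℕ b)  ∎)
    where open ℚᵘ.≤-Reasoning

  fromℕ-∸ : ∀ {a b} → b ℕ.≤ a → fromℕ (a ∸ b) ≡ fromℕ a - fromℕ b
  fromℕ-∸ {a} {b} b≤a = begin
    fromℕ (a ∸ b)                        ≡⟨ solve 2 (λ x y → x := (x :+ y) :- y) refl (fromℕ (a ∸ b)) (fromℕ b) ⟩
    (fromℕ (a ∸ b) + fromℕ b) - fromℕ b  ≡⟨ cong (_- fromℕ b) (fromℕ-+ (a ∸ b) b) ⟨
    fromℕ (a ∸ b ℕ.+ b) - fromℕ b        ≡⟨ cong (λ c → fromℕ c - fromℕ b) (ℕ.m∸n+n≡m b≤a) ⟩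
    fromℕ a - fromℕ b                    ∎
    where open ≡-Reasoning

  fromℕ-*-1/ : ∀ m .{{_ : ℕ.NonZero m}} → fromℕ m * (+ 1 / m) ≡ 1ℚ
  fromℕ-*-1/ (suc m) = toℚᵘ-injective (begin
    toℚᵘ (fromℕ (suc m) * (+ 1 / suc m))            ≈⟨ toℚᵘ-homo-* (fromℕ (suc m)) (+ 1 / suc m) ⟩
    toℚᵘ (fromℕ (suc m)) ℚᵘ.* toℚᵘ (+ 1 / suc m)    ≈⟨ ℚᵘ.*-cong (toℚᵘ-fromℕ (suc m)) (toℚᵘ-fromℚᵘ (mkℚᵘ (+ 1) m)) ⟩
    mkℚᵘ (+ suc m) 0 ℚᵘ.* mkℚᵘ (+ 1) m              ≈⟨ *≡* (trans (ℤ.*-identityʳ (+ suc m ℤ.* + 1)) (trans (ℤ.*-comm (+ suc m) (+ 1)) (cong (λ c → + 1 ℤ.* + suc c) (sym (ℕ.+-identityʳ m))))) ⟩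
    toℚᵘ 1ℚ                                         ∎)
    where open ℚᵘ.≃-Reasoning

  2^D*1/2^ : ∀ {a D} → a ℕ.≤ D → fromℕ (2 ^ D) * 1/2^ a ≡ fromℕ (2 ^ (D ∸ a))
  2^D*1/2^ {a} {D} a≤D = begin
    fromℕ (2 ^ D) * h                            ≡⟨ cong (λ e → fromℕ (2 ^ e) * h) (ℕ.m+[n∸m]≡n a≤D) ⟨
    fromℕ (2 ^ (a ℕ.+ (D ∸ a))) * h              ≡⟨ cong (λ c → fromℕ c * h) (ℕ.^-distribˡ-+-* 2 a (D ∸ a)) ⟩
    fromℕ (2 ^ a ℕ.* 2 ^ (D ∸ a)) * h            ≡⟨ cong (_* h) (fromℕ-* (2 ^ a) (2 ^ (D ∸ a))) ⟩
    fromℕ (2 ^ a) * r * h                        ≡⟨ solve 3 (λ x r h → x :* r :* h := x :* h :* r) refl (fromℕ (2 ^ a)) r h ⟩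
    fromℕ (2 ^ a) * h * r                        ≡⟨ cong (_* r) (fromℕ-*-1/ (2 ^ a) {{ℕ.m^n≢0 2 a}}) ⟩
    1ℚ * r                                       ≡⟨ *-identityˡ r ⟩
    r                                            ∎
    where
    open ≡-Reasoning
    h = 1/2^ a
    r = fromℕ (2 ^ (D ∸ a))

  scaled-∑ : ∀ {p} N (f : Fin p → ℚ) (g : Fin p → ℕ) → (∀ i → N * f i ≡ fromℕ (g i)) →
    N * Σℚ.sum f ≡ fromℕ (Σℕ.sum g)
  scaled-∑ {zero}  N f g h = *-zeroʳ N
  scaled-∑ {suc p} N f g h = begin
    N * (f zero + Σℚ.sum (f ∘ suc))            ≡⟨ *-distribˡ-+ N (f zero) _ ⟩
    N * f zero + N * Σℚ.sum (f ∘ suc)          ≡⟨ cong₂ _+_ (h zero) (scaled-∑ N (f ∘ suc) (g ∘ suc) (h ∘ suc)) ⟩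
    fromℕ (g zero) + fromℕ (Σℕ.sum (g ∘ suc))  ≡⟨ fromℕ-+ (g zero) _ ⟨
    fromℕ (Σℕ.sum g)                           ∎
    where open ≡-Reasoning

  -- Shaped so that D = d ∸ k and b j = |B_{k+2j}| make it unfold to the sum in the theorem.
  weightedSum : ℕ → ℕ → (ℕ → ℕ) → ℚ
  weightedSum D p b = ∑[ j < p ] ((1/2^ (suc (toℕ j)) - 1/2^ (D ∸ toℕ j)) * fromℕ (b (toℕ j)))

  -- For j < p and 2p ≤ D one has 2^j ≤ 2^(D-j-1), so the truncated difference in `coeff` agrees
  -- with the rational one.
  scaled-weightedSum : ∀ {D p} b → p ℕ.+ p ℕ.≤ D →
    fromℕ (2 ^ D) * weightedSum D p b ≡ fromℕ (Σℕ.sum {p} (λ j → coeff D (toℕ j) ℕ.* b (toℕ j)))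
  scaled-weightedSum {D} {p} b p+p≤D = scaled-∑ N _ _ (λ j → term (toℕ j) (toℕ<n j))
    where
    open ≡-Reasoning
    N = fromℕ (2 ^ D)
    term : ∀ j → j ℕ.< p → N * ((1/2^ (suc j) - 1/2^ (D ∸ j)) * fromℕ (b j)) ≡ fromℕ (coeff D j ℕ.* b j)
    term j j<p = begin
      N * ((1/2^ (suc j) - 1/2^ (D ∸ j)) * fromℕ (b j))      ≡⟨ solve 4 (λ n x y z → n :* ((x :- y) :* z) := (n :* x :- n :* y) :* z) refl N (1/2^ (suc j)) (1/2^ (D ∸ j)) (fromℕ (b j)) ⟩
      (N * 1/2^ (suc j) - N * 1/2^ (D ∸ j)) * fromℕ (b j)    ≡⟨ cong₂ (λ x y → (x - y) * fromℕ (b j)) (2^D*1/2^ 1+j≤D) (2^D*1/2^ (ℕ.m∸n≤m D j)) ⟩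
      (fromℕ (2 ^ (D ∸ suc j)) - fromℕ (2 ^ (D ∸ (D ∸ j)))) * fromℕ (b j) ≡⟨ cong (λ e → (fromℕ (2 ^ (D ∸ suc j)) - fromℕ (2 ^ e)) * fromℕ (b j)) (ℕ.m∸[m∸n]≡n (ℕ.<⇒≤ 1+j≤D)) ⟩
      (fromℕ (2 ^ (D ∸ suc j)) - fromℕ (2 ^ j)) * fromℕ (b j) ≡⟨ cong (_* fromℕ (b j)) (fromℕ-∸ (ℕ.^-monoʳ-≤ 2 j≤)) ⟨
      fromℕ (coeff D j) * fromℕ (b j)                        ≡⟨ fromℕ-* (coeff D j) (b j) ⟨
      fromℕ (coeff D j ℕ.* b j)                              ∎
      where
      j+1+j≤D : suc j ℕ.+ j ℕ.≤ D
      j+1+j≤D = ℕ.≤-trans (ℕ.+-mono-≤ j<p (ℕ.<⇒≤ j<p)) p+p≤D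
      1+j≤D : suc j ℕ.≤ D
      1+j≤D = ℕ.m+n≤o⇒m≤o (suc j) j+1+j≤D
      j≤ : j ℕ.≤ D ∸ suc j
      j≤ = ℕ.m+n≤o⇒m≤o∸n j (ℕ.≤-trans (ℕ.≤-reflexive (ℕ.+-suc j j)) j+1+j≤D)

  unscale : ∀ D n (x : ℚ) (r : ℕ) → fromℕ (2 ^ D) * x ≡ fromℕ r → 2 ^ D ℕ.* n ℕ.≤ r → fromℕ n ≤ x
  unscale D n x r eq le = *-cancelˡ-≤-pos (fromℕ (2 ^ D)) {{positive N>0}} (begin
    fromℕ (2 ^ D) * fromℕ n  ≡⟨ fromℕ-* (2 ^ D) n ⟨
    fromℕ (2 ^ D ℕ.* n)      ≤⟨ fromℕ-mono le ⟩
    fromℕ r                  ≡⟨ eq ⟨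
    fromℕ (2 ^ D) * x        ∎)
    where
    open ≤-Reasoning
    N>0 : 0ℚ < fromℕ (2 ^ D)
    N>0 = <-≤-trans (positive⁻¹ 1ℚ) (fromℕ-mono (ℕ.m^n>0 2 D))

  unscale-even : ∀ p e n b {x} → x ≡ p ℕ.+ p ℕ.+ e →
    2 ^ (p ℕ.+ p) ℕ.* n ℕ.≤ Σℕ.sum {p} (λ j → coeff (p ℕ.+ p) (toℕ j) ℕ.* b (toℕ j)) ℕ.+ 2 ^ x →
    fromℕ n ≤ weightedSum (p ℕ.+ p) p b + fromℕ (2 ^ e)
  unscale-even p e n b refl = unscale D n _ _ (begin
    N * (weightedSum D p b + fromℕ (2 ^ e))          ≡⟨ *-distribˡ-+ N _ _ ⟩
    N * weightedSum D p b + N * fromℕ (2 ^ e)        ≡⟨ cong₂ _+_ (scaled-weightedSum {D} {p} b ℕ.≤-refl) (sym (fromℕ-* (2 ^ D) (2 ^ e))) ⟩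
    fromℕ s + fromℕ (2 ^ D ℕ.* 2 ^ e)                ≡⟨ cong (λ c → fromℕ s + fromℕ c) (ℕ.^-distribˡ-+-* 2 D e) ⟨
    fromℕ s + fromℕ (2 ^ (D ℕ.+ e))                  ≡⟨ fromℕ-+ s _ ⟨
    fromℕ (s ℕ.+ 2 ^ (D ℕ.+ e))                      ∎)
    where
    open ≡-Reasoning
    D = p ℕ.+ p
    N = fromℕ (2 ^ D)
    s = Σℕ.sum {p} (λ j → coeff D (toℕ j) ℕ.* b (toℕ j))

  unscale-odd : ∀ p e n b c {x} → x ≡ p ℕ.+ suc p ℕ.+ e →
    2 ^ (p ℕ.+ suc p) ℕ.* n ℕ.≤
      Σℕ.sum {p} (λ j → coeff (p ℕ.+ suc p) (toℕ j) ℕ.* b (toℕ j)) ℕ.+ 2 ^ p ℕ.* c ℕ.+ 2 ^ x →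
    fromℕ n ≤ weightedSum (p ℕ.+ suc p) p b + 1/2^ (suc p) * fromℕ c + fromℕ (2 ^ e)
  unscale-odd p e n b c refl = unscale D n _ _ (begin
    N * (w + h * fromℕ c + fromℕ (2 ^ e))            ≡⟨ solve 5 (λ n w h c e → n :* (w :+ h :* c :+ e) := n :* w :+ n :* h :* c :+ n :* e) refl N w h (fromℕ c) (fromℕ (2 ^ e)) ⟩
    N * w + N * h * fromℕ c + N * fromℕ (2 ^ e)      ≡⟨ cong₂ _+_ (cong₂ (λ x y → x + y * fromℕ c) (scaled-weightedSum {D} {p} b (ℕ.+-monoʳ-≤ p (ℕ.n≤1+n p))) N*h) (sym (fromℕ-* (2 ^ D) (2 ^ e))) ⟩
    fromℕ s + fromℕ (2 ^ p) * fromℕ c + fromℕ (2 ^ D ℕ.* 2 ^ e) ≡⟨ cong₂ (λ x y → fromℕ s + x + fromℕ y) (fromℕ-* (2 ^ p) c) (ℕ.^-distribˡ-+-* 2 D e) ⟨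
    fromℕ s + fromℕ (2 ^ p ℕ.* c) + fromℕ (2 ^ (D ℕ.+ e)) ≡⟨ cong (_+ fromℕ (2 ^ (D ℕ.+ e))) (fromℕ-+ s _) ⟨
    fromℕ (s ℕ.+ 2 ^ p ℕ.* c) + fromℕ (2 ^ (D ℕ.+ e))  ≡⟨ fromℕ-+ (s ℕ.+ 2 ^ p ℕ.* c) _ ⟨
    fromℕ (s ℕ.+ 2 ^ p ℕ.* c ℕ.+ 2 ^ (D ℕ.+ e))      ∎)
    where
    open ≡-Reasoning
    D = p ℕ.+ suc p
    N = fromℕ (2 ^ D)
    h = 1/2^ (suc p)
    w = weightedSum D p b
    s = Σℕ.sum {p} (λ j → coeff D (toℕ j) ℕ.* b (toℕ j))
    N*h : N * h ≡ fromℕ (2 ^ p)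
    N*h = trans (2^D*1/2^ (ℕ.m≤n+m (suc p) p)) (cong (λ e → fromℕ (2 ^ e)) (ℕ.m+n∸n≡m p (suc p)))

open import Data.Fin.Base using (toℕ)
open import Data.List.Base using (length)
open import Data.Nat.Base as ℕ using (ℕ; suc; _∸_; _^_)
open import Data.Nat.Divisibility using (_∣_; _∤_)
open import Data.Nat.DivMod using (_/_)
open import Data.Product.Base using (_×_)
open import Data.Rational.Base using (_+_; _-_; _*_; _≤_)
open import Data.Rational.Properties using (+-0-commutativeMonoid)
open import Algebra.Properties.CommutativeMonoid.Sum +-0-commutativeMonoid using (sum-syntax)
open import Data.Nat.DivMod using (m*n/n≡m; m≡m%n+[m/n]*n; m%n<n; _%_)
open import Data.Nat.Divisibility using (divides; m%n≡0⇒n∣m)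
import Data.Nat.Properties as ℕ
open import Data.Nat.Solver using (module +-*-Solver)
open import Data.Product.Base using (_,_)
open import Relation.Binary.PropositionalEquality
open import Relation.Nullary using (contradiction)
open +-*-Solver using (solve; _:+_; _:*_; _:=_; con)
open Codes using (size-even; size-odd)
open Boxes using (code; code-separated; code-close)
open Scaling using (unscale-even; unscale-odd)

-- The two parities of d - k.

half-even : ∀ {D} → 2 ∣ D → D ≡ D / 2 ℕ.+ D / 2
half-even (divides p refl) = trans (solve 1 (λ p → p :* con 2 := p :+ p) refl p)
  (sym (cong (λ h → h ℕ.+ h) (m*n/n≡m p 2)))

half-odd : ∀ {D} → 2 ∤ D → D ≡ (D ∸ 1) / 2 ℕ.+ suc ((D ∸ 1) / 2)
half-odd {D} 2∤D with D % 2 in r | m%n<n D 2 | m≡m%n+[m/n]*n D 2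
... | 0 | _ | _  = contradiction (m%n≡0⇒n∣m D 2 r) 2∤D
... | suc (suc _) | ℕ.s≤s (ℕ.s≤s ()) | _
... | 1 | _ | eq = trans eq (trans (solve 1 (λ p → con 1 :+ p :* con 2 := p :+ (con 1 :+ p)) refl (D / 2))
  (cong (λ h → h ℕ.+ suc h) (sym (trans (cong (λ n → (n ∸ 1) / 2) eq) (m*n/n≡m (D / 2) 2)))))

family-bound-even : ∀ k d n p → 1 ℕ.≤ d → p ℕ.+ p ℕ.+ k ≡ d → NeighborlyFamily k d n →
  fromℕ n ≤ Scaling.weightedSum (p ℕ.+ p) p (λ j → length (B (k ℕ.+ 2 ℕ.* j) d)) + fromℕ (2 ^ ((d ℕ.+ k) / 2))
family-bound-even k d n p 1≤d eq F = unscale-even p ((d ℕ.+ k) / 2) n (λ j → length (B (k ℕ.+ 2 ℕ.* j) d))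
  exponent (size-even (code 1≤d F) (code-separated 1≤d F) (code-close 1≤d F) p eq)
  where
  half : (d ℕ.+ k) / 2 ≡ p ℕ.+ k
  half = trans (cong (_/ 2) (trans (cong (ℕ._+ k) (sym eq))
    (solve 2 (λ p k → p :+ p :+ k :+ k := (p :+ k) :* con 2) refl p k))) (m*n/n≡m (p ℕ.+ k) 2)
  exponent : d ℕ.+ p ≡ p ℕ.+ p ℕ.+ (d ℕ.+ k) / 2
  exponent = trans (cong (ℕ._+ p) (sym eq)) (trans
    (solve 2 (λ p k → p :+ p :+ k :+ p := p :+ p :+ (p :+ k)) refl p k) (cong (p ℕ.+ p ℕ.+_) (sym half)))

family-bound-odd : ∀ k d n p → 1 ℕ.≤ d → p ℕ.+ suc p ℕ.+ k ≡ d → NeighborlyFamily k d n →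
  fromℕ n ≤ Scaling.weightedSum (p ℕ.+ suc p) p (λ j → length (B (k ℕ.+ 2 ℕ.* j) d))
    + 1/2^ (suc p) * fromℕ (length (B (d ∸ 1) d)) + fromℕ (2 ^ ((d ℕ.+ k ∸ 1) / 2))
family-bound-odd k d n p 1≤d eq F = unscale-odd p ((d ℕ.+ k ∸ 1) / 2) n (λ j → length (B (k ℕ.+ 2 ℕ.* j) d))
  (length (B (d ∸ 1) d)) exponent (size-odd (code 1≤d F) (code-separated 1≤d F) (code-close 1≤d F) p eq)
  where
  half : (d ℕ.+ k ∸ 1) / 2 ≡ p ℕ.+ k
  half = trans (cong (λ m → (m ∸ 1) / 2) (trans (cong (ℕ._+ k) (sym eq))
    (solve 2 (λ p k → p :+ (con 1 :+ p) :+ k :+ k := con 1 :+ (p :+ k) :* con 2) refl p k))) (m*n/n≡m (p ℕ.+ k) 2)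
  exponent : d ℕ.+ p ≡ p ℕ.+ suc p ℕ.+ (d ℕ.+ k ∸ 1) / 2
  exponent = trans (cong (ℕ._+ p) (sym eq)) (trans
    (solve 2 (λ p k → p :+ (con 1 :+ p) :+ k :+ p := p :+ (con 1 :+ p) :+ (p :+ k)) refl p k)
    (cong (p ℕ.+ suc p ℕ.+_) (sym half)))

theorem1p4 : (k d n : ℕ) → 1 ℕ.≤ k → k ℕ.≤ d ∸ 1 → IsNeighborlyNumber k d n →
    (2 ∣ (d ∸ k) →
    fromℕ n ≤ (∑[ j < (d ∸ k) / 2 ] ((1/2^ (suc (toℕ j)) - 1/2^ (d ∸ k ∸ toℕ j)) * fromℕ (length (B (k ℕ.+ 2 ℕ.* toℕ j) d))))
    + fromℕ (2 ^ ((d ℕ.+ k) / 2)))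
    ×
    (2 ∤ (d ∸ k) →
    fromℕ n ≤ (∑[ j < (d ∸ k ∸ 1) / 2 ] ((1/2^ (suc (toℕ j)) - 1/2^ (d ∸ k ∸ toℕ j)) * fromℕ (length (B (k ℕ.+ 2 ℕ.* toℕ j) d))))
    + 1/2^ ((d ∸ k ℕ.+ 1) / 2) * fromℕ (length (B (d ∸ 1) d))
    + fromℕ (2 ^ ((d ℕ.+ k ∸ 1) / 2)))
theorem1p4 k d n 1≤k k≤d-1 isN = even , odd
  where
  k≤d : k ℕ.≤ d
  k≤d = ℕ.≤-trans k≤d-1 (ℕ.m∸n≤m d 1)
  1≤d : 1 ℕ.≤ d
  1≤d = ℕ.≤-trans 1≤k k≤d
  F : NeighborlyFamily k d n
  F = IsNeighborlyNumber.attained isN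
  even : 2 ∣ (d ∸ k) → _
  -- Only the D in the exponents is transported; the number of summands remains (d ∸ k) / 2.
  even 2∣ = subst
    (λ D → fromℕ n ≤ Scaling.weightedSum D ((d ∸ k) / 2) (λ j → length (B (k ℕ.+ 2 ℕ.* j) d)) + fromℕ (2 ^ ((d ℕ.+ k) / 2)))
    (sym D≡) (family-bound-even k d n p 1≤d (trans (cong (ℕ._+ k) (sym D≡)) (ℕ.m∸n+n≡m k≤d)) F)
    where
    p = (d ∸ k) / 2
    D≡ : d ∸ k ≡ p ℕ.+ p
    D≡ = half-even 2∣
  odd : 2 ∤ (d ∸ k) → _
  odd 2∤ = subst₂
    (λ D q → fromℕ n ≤ Scaling.weightedSum D p (λ j → length (B (k ℕ.+ 2 ℕ.* j) d))
      + 1/2^ q * fromℕ (length (B (d ∸ 1) d)) + fromℕ (2 ^ ((d ℕ.+ k ∸ 1) / 2)))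
    (sym D≡) (sym q≡) (family-bound-odd k d n p 1≤d (trans (cong (ℕ._+ k) (sym D≡)) (ℕ.m∸n+n≡m k≤d)) F)
    where
    p = (d ∸ k ∸ 1) / 2
    D≡ : d ∸ k ≡ p ℕ.+ suc p
    D≡ = half-odd 2∤
    q≡ : (d ∸ k ℕ.+ 1) / 2 ≡ suc p
    q≡ = trans (cong (λ D → (D ℕ.+ 1) / 2) D≡) (trans
      (cong (_/ 2) (solve 1 (λ p → p :+ (con 1 :+ p) :+ con 1 := (con 1 :+ p) :* con 2) refl p)) (m*n/n≡m (suc p) 2))
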